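{- Let $k$ and $r$ be integers with $0\le r\le k-3$. Every graph of order $n$ and size more than $\frac{(k-1)n}{2}$ contains (as a subgraph, not necessarily induced) a keyring of size at least $k$ and with $r$ leaves.
   Context: All graphs are finite, simple and undirected. The order of a graph is its number of vertices and its size is its number of edges. A vertex of a graph is a leaf if it has degree one. A keyring with $r\ge 0$ leaves is a graph obtained from a cycle (of length at least 3) by appending $r$ leaves to one of its vertices, i.e., by adding $r$ new vertices, each joined by a single edge to one and the same fixed vertex of the cycle. -}

module Defs where

open import Data.Empty using (⊥)
open import Data.Fin using (Fin; toℕ; splitAt; _<?_)
open import Data.Fin.Properties using (_≟_)
open import Data.List using (List; length; filter; allFin; cartesianProduct)
open import Data.Nat using (ℕ; suc; _+_)
import Data.Nat.Properties as ℕ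
open import Data.Product using (Σ; _×_; _,_; proj₁; proj₂)
open import Data.Sum using (_⊎_; inj₁; inj₂; swap)
open import Function.Definitions using (Injective)
open import Level using (0ℓ)
open import Relation.Binary using (Rel; Decidable; Symmetric; Irreflexive)
open import Relation.Binary.PropositionalEquality using (_≡_; refl; sym)
open import Relation.Nullary.Decidable using (no; _×-dec_; _⊎-dec_)

record Graph (n : ℕ) : Set₁ where
  field
    Adj    : Rel (Fin n) 0ℓ
    adj?   : Decidable Adj
    symm   : Symmetric Adj
    irrefl : Irreflexive _≡_ Adj

open Graph public

-- Each edge {i , j} is listed once, as the pair with i < j.
edges : ∀ {n} → Graph n → List (Fin n × Fin n)
edges {n} G =
  filter (λ e → (proj₁ e <? proj₂ e) ×-dec adj? G (proj₁ e) (proj₂ e))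
         (cartesianProduct (allFin n) (allFin n))

size : ∀ {n} → Graph n → ℕ
size G = length (edges G)

-- G has a (not necessarily induced) subgraph isomorphic to H.
_Contains_ : ∀ {m n} → Graph n → Graph m → Set
_Contains_ {m} {n} G H =
  Σ (Fin m → Fin n) λ f →
    Injective _≡_ _≡_ f × (∀ x y → Adj H x y → Adj G (f x) (f y))

-- y follows x in the cyclic order 0, 1, …, n - 1, 0.
Next : ∀ {n} → Rel (Fin n) 0ℓ
Next {n} x y = (toℕ y ≡ suc (toℕ x)) ⊎ ((suc (toℕ x) ≡ n) × (toℕ y ≡ 0))

next? : ∀ {n} → Decidable (Next {n})
next? {n} x y =
  (toℕ y ℕ.≟ suc (toℕ x)) ⊎-dec ((suc (toℕ x) ℕ.≟ n) ×-dec (toℕ y ℕ.≟ 0))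

next-irrefl : ∀ {m} → Irreflexive _≡_ (Next {3 + m})
next-irrefl refl (inj₁ p) = ℕ.1+n≢n (sym p)
next-irrefl {x = Fin.zero} refl (inj₂ (() , _))
next-irrefl {x = Fin.suc _} refl (inj₂ (_ , ()))

-- The cycle of length 3 + m, so that m ranges over exactly the cycles.
cycle : ∀ m → Graph (3 + m)
cycle m .Adj x y = Next x y ⊎ Next y x
cycle m .adj? x y = next? x y ⊎-dec next? y x
cycle m .symm = swap
cycle m .irrefl p (inj₁ q) = next-irrefl p q
cycle m .irrefl p (inj₂ q) = next-irrefl (sym p) q

module _ {n} (G : Graph n) (v : Fin n) (r : ℕ) where

  LeafAdj : Rel (Fin r ⊎ Fin n) 0ℓ
  LeafAdj (inj₁ _) (inj₁ _) = ⊥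
  LeafAdj (inj₁ _) (inj₂ y) = y ≡ v
  LeafAdj (inj₂ x) (inj₁ _) = x ≡ v
  LeafAdj (inj₂ x) (inj₂ y) = Adj G x y

  leafAdj? : Decidable LeafAdj
  leafAdj? (inj₁ _) (inj₁ _) = no λ ()
  leafAdj? (inj₁ _) (inj₂ y) = y ≟ v
  leafAdj? (inj₂ x) (inj₁ _) = x ≟ v
  leafAdj? (inj₂ x) (inj₂ y) = adj? G x y

  leafAdj-symm : Symmetric LeafAdj
  leafAdj-symm {inj₁ _} {inj₂ _} p = p
  leafAdj-symm {inj₂ _} {inj₁ _} p = p
  leafAdj-symm {inj₂ _} {inj₂ _} p = symm G p

  leafAdj-irrefl : Irreflexive _≡_ LeafAdj
  leafAdj-irrefl {inj₂ _} refl p = irrefl G refl p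

  -- The first r vertices are the new leaves, all joined to v; the remaining
  -- n vertices carry G.
  appendLeaves : Graph (r + n)
  appendLeaves .Adj x y = LeafAdj (splitAt r x) (splitAt r y)
  appendLeaves .adj? x y = leafAdj? (splitAt r x) (splitAt r y)
  appendLeaves .symm {x} {y} = leafAdj-symm {splitAt r x} {splitAt r y}
  appendLeaves .irrefl {x} refl = leafAdj-irrefl {splitAt r x} refl

keyring : ∀ m → Fin (3 + m) → (r : ℕ) → Graph (r + (3 + m))
keyring m v r = appendLeaves (cycle m) v r

{-# OPTIONS --safe #-}
module Submission where

-- Put K = k - 1 and call a vertex set U dense if G[U] has more than K(|U| - 1)/2
-- edges.  In a smallest dense U every proper subset S meets more than K|S|/2
-- edges, no vertex separates U, and some v has at least K neighbours in U.
--
-- Claim: v lies on a cycle of length at least k.  Let v, p₁, p₂, … be a longest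
-- path from v.  If all neighbours of v are on it, the last one closes the cycle.
-- Otherwise consider longest paths from v avoiding the pᵢ.  If their end u is
-- adjacent to some pᵢ, the neighbours of u among the pᵢ start late and are never
-- consecutive, so the last one closes a cycle of length at least 2 deg u > K.
-- If not, rotating such a path and counting the edges at the ends so obtained
-- yields, as in the Erdős–Gallai theorem, a cycle Q of length at least k that
-- avoids the pᵢ.  Since no vertex separates U, a path leads from v through at
-- least half of Q to some pᵢ; by the choice of the longest path it can be no
-- longer than v, p₁, …, pᵢ, so the two together form a cycle of length at least k.
--
-- Finally, the shortest segment of that cycle which starts next to v, has at
-- least K - r vertices and ends in a neighbour of v contains at most K - r
-- neighbours of v; the remaining neighbours supply the r leaves.

open import Defs
open import Data.Fin using (Fin; zero; suc; toℕ; splitAt; _↑ˡ_; _↑ʳ_; _<?_)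
import Data.Fin as Fin
import Data.Fin.Properties as Fin
open import Data.Fin.Properties using (_≟_)
open import Data.Empty using (⊥; ⊥-elim)
open import Data.List
  using (List; []; _∷_; [_]; _++_; length; take; drop; filter; map; reverse; lookup;
         allFin; tabulate; cartesianProduct; cartesianProductWith)
open import Data.Nat.ListAction using (sum)
open import Data.Nat.ListAction.Properties using (sum-++; sum-↭)
open import Data.List.Properties
  using (filter-++; filter-none; filter-some; filter-notAll; length-filter; take++drop≡id;
         length-take; length-++; length-reverse; length-tabulate; ++-identityʳ; ++-assoc;
         map-++; map-cong; reverse-++; unfold-reverse)
import Data.Nat.Properties as ℕ
open import Data.List.Extrema ℕ.≤-totalOrder using (argmax; argmax-all; f[xs]≤f[argmax])
open import Data.List.Membership.Propositional using (_∈_; _∉_; find; lose)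
open import Data.List.Membership.Propositional.Properties
  using (∈-∃++; ∈-++⁺ˡ; ∈-++⁺ʳ; ∈-++⁻; ∈-filter⁺; ∈-filter⁻; ∈-allFin; ∈-cartesianProductWith⁺;
         ∈-cartesianProduct⁺; ∈-lookup; ∈-insert; ∈-length; ∈-tabulate⁻)
open import Data.List.Relation.Binary.Permutation.Propositional
  using (_↭_; refl; prep; swap; trans; ↭-sym; ↭⇒↭ₛ; ↭-reflexive)
open import Data.List.Relation.Binary.Permutation.Propositional.Properties
  using (∈-resp-↭; All-resp-↭; ↭-length; map⁺; ∷↭∷ʳ; filter-↭; shift; ++⁺ˡ; ++⁺ʳ; ↭-reverse;
         ++-commutativeMonoid; ++-comm)
import Data.List.Relation.Binary.Permutation.Setoid.Properties as Permₛ
open import Data.List.Relation.Binary.Subset.Propositional using (_⊆_)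
open import Data.List.Relation.Unary.All using (All; []; _∷_)
import Data.List.Relation.Unary.All as All
open import Data.List.Relation.Unary.All.Properties using (all-filter)
import Data.List.Relation.Unary.All.Properties as All
open import Data.List.Relation.Unary.AllPairs using ([]; _∷_)
open import Data.List.Relation.Unary.Any using (Any; here; there; any?)
open import Data.List.Relation.Unary.Unique.Propositional using (Unique)
import Data.List.Relation.Unary.Unique.Propositional.Properties as Unique
open import Data.List.Relation.Unary.Unique.DecPropositional using (unique?)
open import Data.Nat using (ℕ; zero; suc; _+_; _*_; _∸_; _≤_; _<_; z≤n; s≤s; z<s; s≤s⁻¹)
import Data.Nat as ℕ
open import Data.Nat.Tactic.RingSolver using (solve-∀)
open import Data.Product using (Σ; ∃; ∃₂; _×_; _,_; proj₁; proj₂)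
import Data.Sum as Sum
open import Data.Sum using (_⊎_; inj₁; inj₂; [_,_]′)
open import Function using (_∘_)
open import Level using (0ℓ)
open import Relation.Binary using (Rel; Decidable)
open import Relation.Binary.PropositionalEquality
  using (_≡_; _≢_; refl; sym; cong; cong₂; subst; subst₂; module ≡-Reasoning)
import Relation.Binary.PropositionalEquality as ≡
open import Relation.Binary.Definitions using (tri<; tri≈; tri>)
open import Relation.Nullary using (¬_; Dec; yes; no; contradiction; ¬?)
open import Relation.Nullary.Decidable using (_×-dec_; _⊎-dec_)
open import Relation.Unary using (Pred)
import Relation.Unary as Unary

-- Lists standing for finite sets, and the counting of related pairs

module _ {A : Set} where

  private variable
    x y : A
    xs ys zs : List A

  Unique-resp-↭ : xs ↭ ys → Unique xs → Unique ys
  Unique-resp-↭ p = Permₛ.Unique-resp-↭ (≡.setoid A) (↭⇒↭ₛ p)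

  Unique-++⁻ : ∀ xs → Unique (xs ++ ys) →
               Unique xs × Unique ys × (∀ {w} → w ∈ xs → w ∉ ys)
  Unique-++⁻ [] u = [] , u , λ ()
  Unique-++⁻ (x ∷ xs) (x∉ ∷ u) with Unique-++⁻ xs u
  ... | u₁ , u₂ , disj =
    All.++⁻ˡ xs x∉ ∷ u₁ , u₂ ,
    λ { (here refl) w∈ → All.lookup (All.++⁻ʳ xs x∉) w∈ refl ; (there w∈) → disj w∈ }

  Unique-++⁻ˡ : ∀ xs → Unique (xs ++ ys) → Unique xs
  Unique-++⁻ˡ xs = proj₁ ∘ Unique-++⁻ xs

  ∉⇒Unique-∷ : x ∉ xs → Unique xs → Unique (x ∷ xs)
  ∉⇒Unique-∷ {xs = xs} x∉ u = All.tabulate (λ w∈ eq → x∉ (subst (_∈ xs) (sym eq) w∈)) ∷ u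

  -- With lists standing for sets, `zs` is the set difference. As it comes with a permutation, every
  -- count over `ys` splits into a count over `xs` and one over the rest.
  complement : Unique xs → xs ⊆ ys → ∃ λ zs → ys ↭ xs ++ zs
  complement {[]} {ys} _ _ = ys , refl
  complement {x ∷ xs} u@(_ ∷ u′) xs⊆ with ∈-∃++ (xs⊆ (here refl))
  ... | as , bs , refl with complement u′ (λ w∈ → drop-head w∈ (∈-resp-↭ (shift x as bs) (xs⊆ (there w∈))))
    where
    drop-head : ∀ {w} → w ∈ xs → w ∈ x ∷ as ++ bs → w ∈ as ++ bs
    drop-head w∈ (here refl) = contradiction w∈ (Unique.Unique[x∷xs]⇒x∉xs u)
    drop-head _ (there w∈) = w∈
  ...   | zs , p = zs , trans (shift x as bs) (prep x p)

  Unique-⊆⇒length≤ : Unique xs → xs ⊆ ys → length xs ≤ length ys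
  Unique-⊆⇒length≤ {xs} u xs⊆ with complement u xs⊆
  ... | zs , p = subst (length xs ≤_) (≡.trans (sym (length-++ xs)) (sym (↭-length p))) (ℕ.m≤m+n _ _)

  module _ {P : Pred A 0ℓ} (P? : Unary.Decidable P) where

    firstHit : Any P xs → ∃₂ λ as c → ∃ λ bs → xs ≡ as ++ c ∷ bs × P c × (∀ {w} → w ∈ as → ¬ P w)
    firstHit {x ∷ xs} h with P? x
    ... | yes px = [] , x , xs , refl , px , λ ()
    firstHit {x ∷ xs} (here px) | no ¬px = contradiction px ¬px
    firstHit {x ∷ xs} (there h) | no ¬px with firstHit h
    ... | as , c , bs , refl , pc , none =
      x ∷ as , c , bs , refl , pc , λ { (here refl) → ¬px ; (there w∈) → none w∈ }

    lastHit : Any P xs → ∃₂ λ as c → ∃ λ bs → xs ≡ as ++ c ∷ bs × P c × (∀ {w} → w ∈ bs → ¬ P w)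
    lastHit {x ∷ xs} h with any? P? xs
    lastHit {x ∷ xs} h | yes h′ with lastHit h′
    ... | as , c , bs , refl , pc , none = x ∷ as , c , bs , refl , pc , none
    lastHit {x ∷ xs} (here px) | no ¬h = [] , x , xs , refl , px , λ w∈ pw → ¬h (lose w∈ pw)
    lastHit {x ∷ xs} (there h) | no ¬h = contradiction h ¬h

  sum-map-≤ : ∀ {f g : A → ℕ} xs → (∀ {x} → x ∈ xs → f x ≤ g x) → sum (map f xs) ≤ sum (map g xs)
  sum-map-≤ [] _ = z≤n
  sum-map-≤ (x ∷ xs) le = ℕ.+-mono-≤ (le (here refl)) (sum-map-≤ xs (le ∘ there))

  sum-map-const : ∀ c (xs : List A) → sum (map (λ _ → c) xs) ≡ length xs * c
  sum-map-const c [] = refl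
  sum-map-const c (_ ∷ xs) = cong (c +_) (sum-map-const c xs)

  sum-map-+ : ∀ (f g : A → ℕ) xs → sum (map (λ x → f x + g x) xs) ≡ sum (map f xs) + sum (map g xs)
  sum-map-+ f g [] = refl
  sum-map-+ f g (x ∷ xs) = ≡.trans (cong ((f x + g x) +_) (sum-map-+ f g xs))
    (interchange (f x) (g x) (sum (map f xs)) _)
    where open import Algebra.Properties.CommutativeSemigroup ℕ.+-commutativeSemigroup using (interchange)

  module _ {R : Rel A 0ℓ} (R? : Decidable R) where

    count : A → List A → ℕ
    count x ys = length (filter (R? x) ys)

    -- For adjacency and a duplicate-free list paired with itself this is twice the number of edges
    -- inside the list. Degree sums thus replace edge counts and no halves occur.
    pairs : List A → List A → ℕ
    pairs xs ys = sum (map (λ x → count x ys) xs)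

    count-++ : ∀ x ys zs → count x (ys ++ zs) ≡ count x ys + count x zs
    count-++ x ys zs = ≡.trans (cong length (filter-++ (R? x) ys zs)) (length-++ (filter (R? x) ys))

    count-↭ : ∀ x → ys ↭ zs → count x ys ≡ count x zs
    count-↭ x p = ↭-length (filter-↭ (R? x) p)

    count-none : ∀ {x} ys → (∀ {y} → y ∈ ys → ¬ R x y) → count x ys ≡ 0
    count-none {x} ys none = cong length (filter-none (R? x) (All.tabulate none))

    count>0⇒Any : ∀ {x} ys → 0 < count x ys → Any (R x) ys
    count>0⇒Any {x} ys pos with any? (R? x) ys
    ... | yes h = h
    ... | no ¬h = contradiction (count-none ys λ y∈ r → ¬h (lose y∈ r)) (ℕ.>⇒≢ pos)

    count≡0⇒¬R : ∀ {x} ys → count x ys ≡ 0 → y ∈ ys → ¬ R x y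
    count≡0⇒¬R {x = x} ys eq y∈ r = ℕ.>⇒≢ (filter-some (R? x) (lose y∈ r)) eq

    pairs-++ˡ : ∀ xs ys zs → pairs (xs ++ ys) zs ≡ pairs xs zs + pairs ys zs
    pairs-++ˡ xs ys zs = ≡.trans (cong sum (map-++ _ xs ys)) (sum-++ (map _ xs) (map _ ys))

    pairs-++ʳ : ∀ xs ys zs → pairs xs (ys ++ zs) ≡ pairs xs ys + pairs xs zs
    pairs-++ʳ xs ys zs = ≡.trans (cong sum (map-cong (λ x → count-++ x ys zs) xs)) (sum-map-+ _ _ xs)

    pairs-↭ : ∀ {xs ys ws zs} → xs ↭ ys → ws ↭ zs → pairs xs ws ≡ pairs ys zs
    pairs-↭ {xs} p q = ≡.trans (cong sum (map-cong (λ x → count-↭ x q) xs)) (sum-↭ (map⁺ _ p))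

    pairs-none : ∀ xs ys → (∀ {x y} → x ∈ xs → y ∈ ys → ¬ R x y) → pairs xs ys ≡ 0
    pairs-none [] ys _ = refl
    pairs-none (x ∷ xs) ys none = cong₂ _+_ (count-none ys (none (here refl))) (pairs-none xs ys (none ∘ there))

    pairs-[]ʳ : ∀ xs → pairs xs [] ≡ 0
    pairs-[]ʳ xs = pairs-none xs [] λ _ ()

  -- Double counting by rows and by columns. The two relations are kept apart so that the asymmetric
  -- one in `size-handshake` is covered too.
  pairs-flip : ∀ {R S : Rel A 0ℓ} (R? : Decidable R) (S? : Decidable S) →
               (∀ {x y} → R x y → S y x) → (∀ {x y} → S y x → R x y) →
               ∀ xs ys → pairs R? xs ys ≡ pairs S? ys xs
  pairs-flip R? S? to from [] ys = sym (pairs-[]ʳ S? ys)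
  pairs-flip R? S? to from (x ∷ xs) ys = begin
    count R? x ys + pairs R? xs ys           ≡⟨ cong₂ _+_ (single ys) (pairs-flip R? S? to from xs ys) ⟩
    pairs S? ys [ x ] + pairs S? ys xs       ≡⟨ pairs-++ʳ S? ys [ x ] xs ⟨
    pairs S? ys (x ∷ xs)                     ∎
    where
    open ≡-Reasoning
    single : ∀ ys → count R? x ys ≡ pairs S? ys [ x ]
    single [] = refl
    single (y ∷ ys) with R? x y | S? y x
    ... | yes _ | yes _ = cong suc (single ys)
    ... | no _ | no _ = single ys
    ... | yes r | no ¬s = contradiction (to r) ¬s
    ... | no ¬r | yes s = contradiction (from s) ¬r

  length-filter-cartesianProduct : ∀ {R : Rel A 0ℓ} (R? : Decidable R) xs ys →
    length (filter (λ e → R? (proj₁ e) (proj₂ e)) (cartesianProduct xs ys)) ≡ pairs R? xs ys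
  length-filter-cartesianProduct R? [] ys = refl
  length-filter-cartesianProduct R? (x ∷ xs) ys = begin
    length (filter E? (map (x ,_) ys ++ cartesianProduct xs ys))
      ≡⟨ cong length (filter-++ E? (map (x ,_) ys) _) ⟩
    length (filter E? (map (x ,_) ys) ++ filter E? (cartesianProduct xs ys))
      ≡⟨ length-++ (filter E? (map (x ,_) ys)) ⟩
    length (filter E? (map (x ,_) ys)) + length (filter E? (cartesianProduct xs ys))
      ≡⟨ cong₂ _+_ (row ys) (length-filter-cartesianProduct R? xs ys) ⟩
    count R? x ys + pairs R? xs ys ∎
    where
    open ≡-Reasoning
    E? = λ (e : A × A) → R? (proj₁ e) (proj₂ e)
    row : ∀ ys → length (filter E? (map (x ,_) ys)) ≡ count R? x ys
    row [] = refl
    row (y ∷ ys) with R? x y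
    ... | yes _ = cong suc (row ys)
    ... | no _ = row ys

  length-filter-⊎ : ∀ {P Q R : Pred A 0ℓ}
    (P? : Unary.Decidable P) (Q? : Unary.Decidable Q) (R? : Unary.Decidable R) →
    (∀ {x} → P x → ¬ Q x) → (∀ {x} → P x ⊎ Q x → R x) → (∀ {x} → R x → P x ⊎ Q x) →
    ∀ xs → length (filter P? xs) + length (filter Q? xs) ≡ length (filter R? xs)
  length-filter-⊎ P? Q? R? disj to from [] = refl
  length-filter-⊎ P? Q? R? disj to from (x ∷ xs) with P? x | Q? x | R? x
  ... | yes p | yes q | _ = contradiction q (disj p)
  ... | yes _ | no _ | yes _ = cong suc (length-filter-⊎ P? Q? R? disj to from xs)
  ... | no _ | yes _ | yes _ = ≡.trans (ℕ.+-suc _ _) (cong suc (length-filter-⊎ P? Q? R? disj to from xs))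
  ... | no _ | no _ | no _ = length-filter-⊎ P? Q? R? disj to from xs
  ... | yes p | no _ | no ¬r = contradiction (to (inj₁ p)) ¬r
  ... | no _ | yes q | no ¬r = contradiction (to (inj₂ q)) ¬r
  ... | no ¬p | no ¬q | yes r = contradiction (from r) [ ¬p , ¬q ]′

  listsUpTo : List A → ℕ → List (List A)
  listsUpTo as zero = [ [] ]
  listsUpTo as (suc N) = [] ∷ cartesianProductWith _∷_ as (listsUpTo as N)

  ∈-listsUpTo : ∀ {as xs} N → xs ⊆ as → length xs ≤ N → xs ∈ listsUpTo as N
  ∈-listsUpTo {xs = []} zero _ _ = here refl
  ∈-listsUpTo {xs = []} (suc N) _ _ = here refl
  ∈-listsUpTo {xs = x ∷ xs} (suc N) sub (s≤s le) =
    there (∈-cartesianProductWith⁺ _∷_ (sub (here refl)) (∈-listsUpTo N (sub ∘ there) le))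

-- Exhaustive search over duplicate-free lists of vertices

module _ {n : ℕ} where

  private
    V = Fin n

  Unique⇒length≤ : {xs : List V} → Unique xs → length xs ≤ n
  Unique⇒length≤ {xs} u = subst (length xs ≤_) (length-tabulate {n = n} (λ i → i)) (Unique-⊆⇒length≤ u λ _ → ∈-allFin _)

  module _ {P : Pred (List V) 0ℓ} (P? : Unary.Decidable P) (unique : ∀ {xs} → P xs → Unique xs) where

    private
      ∈-lists : ∀ {xs} → P xs → xs ∈ listsUpTo (allFin n) n
      ∈-lists p = ∈-listsUpTo n (λ _ → ∈-allFin _) (Unique⇒length≤ (unique p))

    -- A duplicate-free list has at most `n` entries and so occurs in a finite list of candidates.
    -- Together with `maximal` this makes the case distinctions and extremal choices below
    -- constructive.
    anyList? : Dec (∃ P)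
    anyList? with any? P? (listsUpTo (allFin n) n)
    ... | yes h = let xs , _ , p = find h in yes (xs , p)
    ... | no ¬h = no λ (xs , p) → ¬h (lose (∈-lists p) p)

    maximal : (μ : List V → ℕ) → ∃ P → ∃ λ ys → P ys × (∀ {zs} → P zs → μ zs ≤ μ ys)
    maximal μ (xs , p) = argmax μ xs cands
      , argmax-all μ p (all-filter P? (listsUpTo (allFin n) n))
      , λ pz → All.lookup (f[xs]≤f[argmax] xs cands) (∈-filter⁺ P? (∈-lists pz) pz)
      where
      cands = filter P? (listsUpTo (allFin n) n)

-- The handshake identity and the size of a keyring

size-handshake : ∀ {n} (G : Graph n) → 2 * size G ≡ pairs (adj? G) (allFin n) (allFin n)
size-handshake {n} G = begin
  2 * size G                           ≡⟨ cong (size G +_) (ℕ.+-identityʳ (size G)) ⟩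
  size G + size G                      ≡⟨ cong₂ _+_ size≡ size≡ ⟩
  -- `edges` keeps the pairs whose smaller end comes first. Exchanging the ends turns one of the two
  -- copies into the pairs whose larger end comes first.
  pairs lt? A A + pairs lt? A A        ≡⟨ cong (pairs lt? A A +_) (pairs-flip lt? gt? (λ p → p) (λ p → p) A A) ⟩
  pairs lt? A A + pairs gt? A A        ≡⟨ sum-map-+ _ _ A ⟨
  sum (map (λ x → count lt? x A + count gt? x A) A)
    ≡⟨ cong sum (map-cong (λ x → length-filter-⊎ (lt? x) (gt? x) (adj? G x) asym to from A) A) ⟩
  pairs (adj? G) A A                   ∎
  where
  open ≡-Reasoning
  A = allFin n
  lt? : Decidable λ x y → (x Fin.< y) × Adj G x y
  lt? x y = (x <? y) ×-dec adj? G x y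
  size≡ : size G ≡ pairs lt? A A
  size≡ = length-filter-cartesianProduct lt? A A
  gt? : Decidable λ x y → (y Fin.< x) × Adj G y x
  gt? x y = (y <? x) ×-dec adj? G y x
  asym : ∀ {x y} → (x Fin.< y) × Adj G x y → ¬ ((y Fin.< x) × Adj G y x)
  asym (l , _) (g , _) = Fin.<-asym l g
  to : ∀ {x y} → (x Fin.< y) × Adj G x y ⊎ (y Fin.< x) × Adj G y x → Adj G x y
  to (inj₁ (_ , a)) = a
  to (inj₂ (_ , a)) = symm G a
  from : ∀ {x y} → Adj G x y → (x Fin.< y) × Adj G x y ⊎ (y Fin.< x) × Adj G y x
  from {x} {y} a with Fin.<-cmp x y
  ... | tri< l _ _ = inj₁ (l , a)
  ... | tri≈ _ eq _ = ⊥-elim (irrefl G eq a)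
  ... | tri> _ _ g = inj₂ (g , symm G a)

-- The `r` leaf edges and the `3 + m` rim edges are distinct entries of `edges`. Leaves carry the
-- smallest numbers, so in a leaf edge the leaf comes first.
size-keyring : ∀ m v r → r + (3 + m) ≤ size (keyring m v r)
size-keyring m v r = begin
  r + N                                     ≡⟨ cong₂ _+_ (length-tabulate leaf) (length-tabulate rim) ⟨
  length (tabulate leaf) + length (tabulate rim)     ≡⟨ length-++ (tabulate leaf) ⟨
  length (tabulate leaf ++ tabulate rim)
    ≤⟨ Unique-⊆⇒length≤ (Unique.++⁺ (Unique.tabulate⁺ leaf-inj) (Unique.tabulate⁺ rim-inj) disj) incl ⟩
  size H                                    ∎
  where
  open ℕ.≤-Reasoning
  N = 3 + m
  H = keyring m v r
  leaf : Fin r → Fin (r + N) × Fin (r + N)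
  leaf i = i ↑ˡ N , r ↑ʳ v
  -- Index `zero` stands for the closing edge, `suc i` for the edge from `i` to its successor.
  ends : Fin N → Fin N × Fin N
  ends zero = zero , Fin.fromℕ (2 + m)
  ends (suc i) = Fin.inject₁ i , suc i
  rim : Fin N → Fin (r + N) × Fin (r + N)
  rim j = r ↑ʳ proj₁ (ends j) , r ↑ʳ proj₂ (ends j)
  leaf-inj : ∀ {i j} → leaf i ≡ leaf j → i ≡ j
  leaf-inj eq = Fin.↑ˡ-injective N _ _ (cong proj₁ eq)
  ends-inj : ∀ {i j} → ends i ≡ ends j → i ≡ j
  ends-inj {zero} {zero} _ = refl
  -- A cycle has at least three vertices, so its closing edge differs from the edge between the
  -- first two.
  ends-inj {zero} {suc zero} ()
  ends-inj {zero} {suc (suc _)} ()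
  ends-inj {suc zero} {zero} ()
  ends-inj {suc (suc _)} {zero} ()
  ends-inj {suc i} {suc j} eq = cong proj₂ eq
  rim-inj : ∀ {i j} → rim i ≡ rim j → i ≡ j
  rim-inj eq = ends-inj (cong₂ _,_ (Fin.↑ʳ-injective r _ _ (cong proj₁ eq)) (Fin.↑ʳ-injective r _ _ (cong proj₂ eq)))
  disj : ∀ {e} → ¬ (e ∈ tabulate leaf × e ∈ tabulate rim)
  disj (e∈ , e∈′) with ∈-tabulate⁻ {f = leaf} e∈ | ∈-tabulate⁻ {f = rim} e∈′
  ... | i , refl | j , eq with ≡.trans (sym (Fin.splitAt-↑ˡ r i N)) (≡.trans (cong (splitAt r ∘ proj₁) eq) (Fin.splitAt-↑ʳ r N _))
  ... | ()
  edge : ∀ {x y} → x Fin.< y → Adj H x y → (x , y) ∈ edges H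
  edge lt a = ∈-filter⁺ _ (∈-cartesianProduct⁺ (∈-allFin _) (∈-allFin _)) (lt , a)
  ends-< : ∀ j → proj₁ (ends j) Fin.< proj₂ (ends j)
  ends-< zero = z<s
  ends-< (suc i) = s≤s (ℕ.≤-reflexive (Fin.toℕ-inject₁ i))
  ends-adj : ∀ j → Adj (cycle m) (proj₁ (ends j)) (proj₂ (ends j))
  ends-adj zero = inj₂ (inj₂ (cong suc (Fin.toℕ-fromℕ (2 + m)) , refl))
  ends-adj (suc i) = inj₁ (inj₁ (cong suc (sym (Fin.toℕ-inject₁ i))))
  incl : tabulate leaf ++ tabulate rim ⊆ edges H
  incl e∈ with ∈-++⁻ (tabulate leaf) e∈
  ... | inj₁ e∈ˡ with ∈-tabulate⁻ {f = leaf} e∈ˡ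
  ... | i , refl = edge (subst₂ _<_ (sym (Fin.toℕ-↑ˡ i N)) (sym (Fin.toℕ-↑ʳ r v)) (ℕ.<-≤-trans (Fin.toℕ<n i) (ℕ.m≤m+n r _)))
      (subst₂ (LeafAdj (cycle m) v r) (sym (Fin.splitAt-↑ˡ r i N)) (sym (Fin.splitAt-↑ʳ r N v)) refl)
  incl e∈ | inj₂ e∈ʳ with ∈-tabulate⁻ {f = rim} e∈ʳ
  ... | j , refl = edge (subst₂ _<_ (sym (Fin.toℕ-↑ʳ r _)) (sym (Fin.toℕ-↑ʳ r _)) (ℕ.+-monoʳ-< r (ends-< j)))
      (subst₂ (LeafAdj (cycle m) v r) (sym (Fin.splitAt-↑ʳ r N _)) (sym (Fin.splitAt-↑ʳ r N _)) (ends-adj j))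

lookup-injective : ∀ {A : Set} {xs : List A} → Unique xs → ∀ {i j} → lookup xs i ≡ lookup xs j → i ≡ j
lookup-injective (_ ∷ _) {zero} {zero} _ = refl
lookup-injective (x∉ ∷ _) {zero} {suc j} eq = contradiction eq (All.lookup x∉ (∈-lookup j))
lookup-injective (x∉ ∷ _) {suc i} {zero} eq = contradiction (sym eq) (All.lookup x∉ (∈-lookup i))
lookup-injective (_ ∷ u) {suc i} {suc j} eq = cong suc (lookup-injective u eq)

-- Walks and their surgery

module _ {n} (G : Graph n) where

  open import Data.List.Relation.Binary.Subset.DecPropositional (_≟_ {n}) using (_⊆?_)
  open import Data.List.Membership.DecPropositional (_≟_ {n}) using (_∈?_)
  open import Algebra.Solver.CommutativeMonoid (++-commutativeMonoid {A = Fin n}) using (solve; _⊜_; _⊕_)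

  private
    V = Fin n
    variable
      a b c d e : V
      xs ys : List V

  -- The visited vertices, both ends included, form an index, so distinctness and containment become
  -- statements about a list.
  data Walk : V → List V → V → Set where
    [-] : Walk a [ a ] a
    _∷_ : Adj G a b → Walk b xs c → Walk a (a ∷ xs) c

  start≡ : Walk a (b ∷ xs) c → a ≡ b
  start≡ [-] = refl
  start≡ (_ ∷ _) = refl

  start∈ : Walk a xs b → a ∈ xs
  start∈ [-] = here refl
  start∈ (_ ∷ _) = here refl

  end∈ : Walk a xs b → b ∈ xs
  end∈ [-] = here refl
  end∈ (_ ∷ w) = there (end∈ w)

  link : Walk a xs b → Adj G b c → Walk c ys d → Walk a (xs ++ ys) d
  link [-] e w = e ∷ w
  link (e′ ∷ w′) e w = e′ ∷ link w′ e w

  reverseʷ : Walk a xs b → Walk b (reverse xs) a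
  reverseʷ [-] = [-]
  reverseʷ {a} {_ ∷ xs} (e ∷ w) =
    subst (λ zs → Walk _ zs a) (sym (unfold-reverse a xs)) (link (reverseʷ w) (symm G e) [-])

  unlink : ∀ x xs → Walk a (x ∷ xs ++ c ∷ ys) b →
           ∃ λ e → Walk a (x ∷ xs) e × Adj G e c × Walk c (c ∷ ys) b
  unlink x [] (e ∷ w) with start≡ w
  ... | refl = x , [-] , e , w
  unlink x (x′ ∷ xs) (e ∷ w) with unlink x′ xs w
  ... | z , w₁ , e′ , w₂ = z , e ∷ w₁ , e′ , w₂

  join : ∀ xs → Walk a (xs ++ [ c ]) c → Walk c (c ∷ ys) b → Walk a (xs ++ c ∷ ys) b
  join [] w₁ w₂ with start≡ w₁
  ... | refl = w₂
  join (x ∷ xs) w₁ w₂ with unlink x xs w₁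
  ... | _ , w , e , _ = link w e w₂

  cut : ∀ xs → Walk a (xs ++ c ∷ ys) b → Walk a (xs ++ [ c ]) c × Walk c (c ∷ ys) b
  cut [] w with start≡ w
  ... | refl = [-] , w
  cut (x ∷ xs) w with unlink x xs w
  ... | _ , w₁ , e , w₂ = link w₁ e [-] , w₂

  walk? : ∀ a xs b → Dec (Walk a xs b)
  walk? a [] b = no λ ()
  walk? a (x ∷ xs) b with a ≟ x
  walk? a (x ∷ xs) b | no a≢x = no (a≢x ∘ start≡)
  walk? a (a ∷ []) b | yes refl with a ≟ b
  ... | yes refl = yes [-]
  ... | no a≢b = no λ { [-] → a≢b refl ; (_ ∷ ()) }
  walk? a (a ∷ y ∷ ys) b | yes refl with adj? G a y | walk? y (y ∷ ys) b
  ... | yes e | yes w = yes (e ∷ w)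
  ... | yes _ | no ¬w = no λ { (_ ∷ w) → ¬w (subst (λ z → Walk z _ _) (start≡ w) w) }
  ... | no ¬e | _ = no λ { (e ∷ w) → ¬e (subst (Adj G a) (start≡ w) e) }

  -- Cycles and their arcs

  module _ (U : List V) where

    -- A single edge also passes, as a list of two vertices. Cycles longer than a `K` with `2 ≤ K`
    -- are genuine.
    IsCycle : V → List V → Set
    IsCycle a xs = (∃ λ e → Walk a xs e × Adj G e a) × Unique xs × xs ⊆ U

    isCycle? : ∀ a xs → Dec (IsCycle a xs)
    isCycle? a xs =
      Fin.any? (λ e → walk? a xs e ×-dec adj? G e a) ×-dec unique? _≟_ xs ×-dec (xs ⊆? U)

    rotate : ∀ as bs → IsCycle a (as ++ c ∷ bs) → IsCycle c (c ∷ bs ++ as)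
    rotate {a} {c} as bs ((e , w , cl) , u , sub) =
      rotate-walk as w , Unique-resp-↭ (++-comm as (c ∷ bs)) u
      , sub ∘ ∈-resp-↭ (++-comm (c ∷ bs) as)
      where
      rotate-walk : ∀ as → Walk a (as ++ c ∷ bs) e → ∃ λ e′ → Walk c (c ∷ bs ++ as) e′ × Adj G e′ c
      rotate-walk [] w with start≡ w
      ... | refl = e , subst (λ zs → Walk c zs e) (sym (++-identityʳ (c ∷ bs))) w , cl
      rotate-walk (x ∷ as) w with unlink x as w
      ... | z , w₁ , e′ , w₂ = z , link w₂ cl w₁ , e′

    -- Removing `p` and `q` leaves the inner vertices of two arcs. `A` is the larger of these two
    -- sets, so it has at least half of them.
    arc : ∀ {Q p q} → IsCycle a Q → p ∈ Q → q ∈ Q → p ≢ q →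
          ∃ λ A → Walk p (p ∷ A ++ [ q ]) q × Unique (p ∷ A ++ [ q ]) × (p ∷ A ++ [ q ]) ⊆ Q
                × length Q ≤ 2 * suc (length A)
    arc {a} {Q} {p} {q} cyc p∈ q∈ p≢q with ∈-∃++ p∈
    ... | as , bs , refl with rotate as bs cyc | ∈-resp-↭ (++-comm as (p ∷ bs)) q∈
    ... | _ | here refl = contradiction refl p≢q
    ... | (e , w , cl) , u , sub | there q∈′ with ∈-∃++ q∈′
    ... | A , B , eq = choose (ℕ.≤-total (length B) (length A))
      where
      w′ : Walk p (p ∷ A ++ q ∷ B) e
      w′ = subst (λ zs → Walk p (p ∷ zs) e) eq w
      u′ : Unique (p ∷ A ++ q ∷ B)
      u′ = subst (λ zs → Unique (p ∷ zs)) eq u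
      ↭Q : p ∷ A ++ q ∷ B ↭ as ++ p ∷ bs
      ↭Q = trans (↭-reflexive (cong (p ∷_) (sym eq))) (++-comm (p ∷ bs) as)
      len : length (as ++ p ∷ bs) ≡ suc (length A + suc (length B))
      len = ≡.trans (sym (↭-length ↭Q)) (cong suc (length-++ A))
      Arc = ∃ λ A → Walk p (p ∷ A ++ [ q ]) q × Unique (p ∷ A ++ [ q ])
                  × (p ∷ A ++ [ q ]) ⊆ (as ++ p ∷ bs) × length (as ++ p ∷ bs) ≤ 2 * suc (length A)
      long : ∀ m k → k ≤ m → suc (m + suc k) ≤ 2 * suc m
      long m k k≤m = s≤s (ℕ.+-monoʳ-≤ m (s≤s (ℕ.≤-trans k≤m (ℕ.m≤m+n m 0))))
      mk : ∀ A′ M → p ∷ A ++ q ∷ B ↭ (p ∷ A′ ++ [ q ]) ++ M → Walk p (p ∷ A′ ++ [ q ]) q →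
           length (as ++ p ∷ bs) ≤ 2 * suc (length A′) → Arc
      mk A′ M perm w le = A′ , w , Unique-++⁻ˡ (p ∷ A′ ++ [ q ]) (Unique-resp-↭ perm u′)
        , (λ x∈ → ∈-resp-↭ (trans (↭-sym perm) ↭Q) (∈-++⁺ˡ x∈)) , le
      choose : length B ≤ length A ⊎ length A ≤ length B → Arc
      choose (inj₁ B≤A) = mk A B (↭-reflexive (cong (p ∷_) (sym (++-assoc A [ q ] B))))
        (proj₁ (cut (p ∷ A) w′)) (subst (_≤ _) (sym len) (long _ _ B≤A))
      -- The other arc is walked from `p` over the closing edge and then backwards through `B`.
      choose (inj₂ A≤B) = mk (reverse B) A
        (prep p (trans (++-comm A (q ∷ B)) (++⁺ʳ A (trans (∷↭∷ʳ q B) (++⁺ʳ [ q ] (↭-sym (↭-reverse B)))))))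
        (subst (λ zs → Walk p (p ∷ zs) q) (unfold-reverse q B)
          (symm G cl ∷ reverseʷ (proj₂ (cut (p ∷ A) w′))))
        (subst₂ (λ k l → k ≤ 2 * suc l) (sym (≡.trans len (+-suc-comm (length A) (length B))))
          (sym (length-reverse B)) (long (length B) (length A) A≤B))
        where
        +-suc-comm : ∀ k l → suc (k + suc l) ≡ suc (l + suc k)
        +-suc-comm k l = cong suc (≡.trans (ℕ.+-suc k l) (≡.trans (cong suc (ℕ.+-comm k l)) (sym (ℕ.+-suc l k))))

  -- Paths that avoid a given vertex

  module _ {U : List V} (uU : Unique U) where

    -- A search from `w` that never enters `z` cannot get stuck, because by `conn` no part of the
    -- remaining vertices is cut off. It stops at the first vertex of `B` it meets.
    separates⇒path : ∀ z →
      (∀ A C → U ↭ z ∷ A ++ C → ∀ {a c} → a ∈ A → c ∈ C → ∃₂ λ a c → a ∈ A × c ∈ C × Adj G a c) →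
      {B : Pred V 0ℓ} → Unary.Decidable B → ∀ {w b} → z ∈ U → w ∈ U → w ≢ z → b ∈ U → b ≢ z → B b →
      ∃₂ λ W h → Walk w (W ++ [ h ]) h × Unique (W ++ [ h ]) × (W ++ [ h ]) ⊆ U × z ∉ W ++ [ h ]
               × B h × (∀ {x} → x ∈ W → ¬ B x)
    separates⇒path z conn {B} B? {w} {b₀} z∈ w∈ w≢z b∈ b≢z Bb = start
      where
      Reach : List V → V → Set
      Reach A a = ∃ λ W → Walk w (W ++ [ a ]) a × Unique (W ++ [ a ]) × (W ++ [ a ]) ⊆ A × (∀ {x} → x ∈ W → ¬ B x)
      Goal = ∃₂ λ W h → Walk w (W ++ [ h ]) h × Unique (W ++ [ h ]) × (W ++ [ h ]) ⊆ U × z ∉ W ++ [ h ]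
               × B h × (∀ {x} → x ∈ W → ¬ B x)

      -- `A` holds the vertices reached so far, none of them in `B`, and `C` the others except `z`.
      -- The target `b₀` stays in `C`, so `conn` always supplies an edge out of `A`. The size `N` of
      -- `C` drops with each vertex moved.
      grow : ∀ N A C → length C ≡ N → U ↭ z ∷ A ++ C → w ∈ A →
             (∀ {a} → a ∈ A → ¬ B a × Reach A a) → Goal
      grow N A C len p w∈A reach = extend N len (conn A C p w∈A b∈C)
        where
        b∈C : b₀ ∈ C
        b∈C with ∈-resp-↭ p b∈
        ... | here eq = contradiction eq b≢z
        ... | there b∈′ with ∈-++⁻ A b∈′
        ... | inj₁ b∈A = contradiction Bb (proj₁ (reach b∈A))
        ... | inj₂ b∈C = b∈C

        u′ : Unique (z ∷ A ++ C)
        u′ = Unique-resp-↭ p uU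

        extend : ∀ N → length C ≡ N → (∃₂ λ a c → a ∈ A × c ∈ C × Adj G a c) → Goal
        extend N len (a , c , a∈ , c∈ , e) with reach a∈
        ... | ¬Ba , W , walk , uW , W⊆ , none = decide (B? c)
          where
          Wc = (W ++ [ a ]) ++ [ c ]
          walk′ : Walk w Wc c
          walk′ = link walk e [-]
          unique′ : Unique Wc
          unique′ = Unique.++⁺ uW ([] ∷ []) λ { (x∈ , here refl) → proj₂ (proj₂ (Unique-++⁻ (z ∷ A) u′)) (there (W⊆ x∈)) c∈ }
          none′ : ∀ {x} → x ∈ W ++ [ a ] → ¬ B x
          none′ x∈ with ∈-++⁻ W x∈
          ... | inj₁ x∈W = none x∈W
          ... | inj₂ (here refl) = ¬Ba
          Wc⊆ : Wc ⊆ c ∷ A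
          Wc⊆ x∈ with ∈-++⁻ (W ++ [ a ]) x∈
          ... | inj₁ x∈W = there (W⊆ x∈W)
          ... | inj₂ (here refl) = here refl
          Wc⊆A++C : Wc ⊆ A ++ C
          Wc⊆A++C x∈ with Wc⊆ x∈
          ... | here refl = ∈-++⁺ʳ A c∈
          ... | there x∈A = ∈-++⁺ˡ x∈A
          decide : Dec (B c) → Goal
          decide (yes Bc) = W ++ [ a ] , c , walk′ , unique′ , (λ x∈ → ∈-resp-↭ (↭-sym p) (there (Wc⊆A++C x∈)))
            , (λ z∈ → Unique.Unique[x∷xs]⇒x∉xs u′ (Wc⊆A++C z∈)) , Bc , none′
          decide (no ¬Bc) = recurse N len (∈-∃++ c∈)
            where
            reach′ : ∀ {x} → x ∈ c ∷ A → ¬ B x × Reach (c ∷ A) x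
            reach′ (here refl) = ¬Bc , W ++ [ a ] , walk′ , unique′ , Wc⊆ , none′
            reach′ (there x∈) with reach x∈
            ... | ¬Bx , W , walk , uW , W⊆ , none = ¬Bx , W , walk , uW , there ∘ W⊆ , none
            recurse : ∀ N → length C ≡ N → (∃₂ λ as bs → C ≡ as ++ c ∷ bs) → Goal
            recurse zero len (as , bs , refl) =
              contradiction (≡.trans (sym (↭-length (shift c as bs))) len) λ ()
            recurse (suc N) len (as , bs , refl) =
              grow N (c ∷ A) (as ++ bs) (ℕ.suc-injective (≡.trans (sym (↭-length (shift c as bs))) len))
                (trans p (prep z (trans (++⁺ˡ A (shift c as bs)) (shift c A (as ++ bs))))) (there w∈A) reach′

      start : Goal
      start with B? w
      ... | yes Bw = [] , w , [-] , [] ∷ [] , (λ { (here refl) → w∈ }) , (λ { (here z≡w) → w≢z (sym z≡w) }) , Bw , λ ()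
      ... | no ¬Bw with complement {xs = z ∷ [ w ]} (∉⇒Unique-∷ (λ { (here z≡w) → w≢z (sym z≡w) }) ([] ∷ []))
                          (λ { (here refl) → z∈ ; (there (here refl)) → w∈ })
      ... | C , p = grow (length C) [ w ] C refl p (here refl)
        λ { (here refl) → ¬Bw , [] , [-] , [] ∷ [] , (λ x∈ → x∈) , λ () }

  -- Detours and ears attached to them

  module Detours (U : List V) (v : V) (ps : List V) where

    -- L starts at v; the vertex p on ps that it leads to is not part of L.
    record Detour (L : List V) (p : V) : Set where
      constructor detour
      field
        walk : Walk v (L ++ [ p ]) p
        end∈ps : p ∈ ps
        unique : Unique L
        avoids : ∀ {x} → x ∈ L → x ∉ ps
        within : L ⊆ U

    open Detour

    -- By `ρ` the new list uses only vertices of `E` and `L`, so it inherits distinctness, avoidance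
    -- of `ps` and containment in `U`. `π` shows that it covers `r ∷ E`.
    reroute : ∀ {L p E r} → Detour L p → Unique E → (∀ {x} → x ∈ E → x ∉ L) → (∀ {x} → x ∈ E → x ∉ ps) →
              E ⊆ U → ∀ L′ p′ N M → Walk v (L′ ++ [ p′ ]) p′ → p′ ∈ ps →
              L′ ↭ r ∷ E ++ N → E ++ L ↭ L′ ++ M → ∃₂ λ L′ p′ → Detour L′ p′ × (r ∷ E) ⊆ L′
    reroute {E = E} D uE E∩L E∩ps E⊆U L′ p′ N M w p′∈ π ρ = L′ , p′ , detour w p′∈ u′
        (λ x∈ → [ E∩ps , avoids D ]′ (split x∈)) (λ x∈ → [ E⊆U , within D ]′ (split x∈))
      , λ x∈ → ∈-resp-↭ (↭-sym π) (∈-++⁺ˡ x∈)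
      where
      split : ∀ {x} → x ∈ L′ → x ∈ E ⊎ x ∈ _
      split x∈ = ∈-++⁻ E (∈-resp-↭ (↭-sym ρ) (∈-++⁺ˡ x∈))
      u′ : Unique L′
      u′ = Unique-++⁻ˡ L′ (Unique-resp-↭ ρ (Unique.++⁺ uE (unique D) λ (x∈E , x∈L) → E∩L x∈E x∈L))

    -- The ear from `r` to `h` is built into the detour. If `h` lies on `ps`, the ear replaces all
    -- that follows `r`; if `h` comes after `r`, it replaces the stretch between them; if `h` comes
    -- before `r`, the reversed ear replaces that stretch.
    absorb : ∀ {L p r E h} → Detour L p → r ∈ L → Walk r (r ∷ E ++ [ h ]) h → Unique E →
             (∀ {x} → x ∈ E → x ∉ L) → (∀ {x} → x ∈ E → x ∉ ps) → E ⊆ U →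
             h ∈ L ⊎ h ∈ ps → h ≢ r → ∃₂ λ L′ p′ → Detour L′ p′ × (r ∷ E) ⊆ L′
    absorb {p = p} {r} {E} {h} D r∈L ear uE E∩L E∩ps E⊆U h∈ h≢r with ∈-∃++ r∈L
    ... | L₁ , L₂ , refl with cut L₁ (subst (λ zs → Walk v zs p) (++-assoc L₁ (r ∷ L₂) [ p ]) (walk D)) | h∈
    ... | w₁ , w₂ | inj₂ h∈ps = reroute D uE E∩L E∩ps E⊆U (L₁ ++ r ∷ E) h L₁ L₂
      (subst (λ zs → Walk v zs h) (sym (++-assoc L₁ (r ∷ E) [ h ])) (join L₁ w₁ ear)) h∈ps
      (solve 3 (λ l r e → l ⊕ r ⊕ e ⊜ r ⊕ e ⊕ l) refl L₁ [ r ] E)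
      (solve 4 (λ l r m e → e ⊕ l ⊕ r ⊕ m ⊜ (l ⊕ r ⊕ e) ⊕ m) refl L₁ [ r ] L₂ E)
    ... | w₁ , w₂ | inj₁ h∈L with ∈-++⁻ L₁ h∈L
    ... | inj₂ (here h≡r) = contradiction h≡r h≢r
    ... | inj₂ (there h∈L₂) with ∈-∃++ h∈L₂
    ... | A , A′ , refl = reroute D uE E∩L E∩ps E⊆U (L₁ ++ r ∷ E ++ h ∷ A′) p (h ∷ A′ ++ L₁) A
      (subst (λ zs → Walk v zs p)
        (sym (≡.trans (++-assoc L₁ (r ∷ E ++ h ∷ A′) [ p ])
          (cong (λ zs → L₁ ++ r ∷ zs) (++-assoc E (h ∷ A′) [ p ]))))
        (join L₁ w₁ (join (r ∷ E) ear w₃)))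
      (end∈ps D)
      (solve 5 (λ l r e h a → l ⊕ r ⊕ e ⊕ h ⊕ a ⊜ r ⊕ e ⊕ h ⊕ a ⊕ l) refl L₁ [ r ] E [ h ] A′)
      (solve 6 (λ l r e h a b → e ⊕ l ⊕ r ⊕ b ⊕ h ⊕ a ⊜ (l ⊕ r ⊕ e ⊕ h ⊕ a) ⊕ b) refl L₁ [ r ] E [ h ] A′ A)
      where
      w₃ : Walk h (h ∷ A′ ++ [ p ]) p
      w₃ = proj₂ (cut (r ∷ A) (subst (λ zs → Walk r (r ∷ zs) p) (++-assoc A (h ∷ A′) [ p ]) w₂))
    absorb {p = p} {r} {E} {h} D r∈L ear uE E∩L E∩ps E⊆U h∈ h≢r | L₁ , L₂ , refl | w₁ , w₂ | inj₁ h∈L | inj₁ h∈L₁ with ∈-∃++ h∈L₁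
    ... | A , A′ , refl = reroute D uE E∩L E∩ps E⊆U (A ++ h ∷ reverse E ++ r ∷ L₂) p (A ++ h ∷ L₂) A′
      (subst (λ zs → Walk v zs p)
        (sym (≡.trans (++-assoc A (h ∷ reverse E ++ r ∷ L₂) [ p ])
          (cong (λ zs → A ++ h ∷ zs) (++-assoc (reverse E) (r ∷ L₂) [ p ]))))
        (join A w₃ (join (h ∷ reverse E) ear′ w₂)))
      (end∈ps D)
      (trans (++⁺ˡ A (prep h (++⁺ʳ (r ∷ L₂) (↭-reverse E))))
        (solve 5 (λ a h e r m → a ⊕ h ⊕ e ⊕ r ⊕ m ⊜ r ⊕ e ⊕ a ⊕ h ⊕ m) refl A [ h ] E [ r ] L₂))
      (trans (solve 6 (λ a h e r m b → e ⊕ (a ⊕ h ⊕ b) ⊕ r ⊕ m ⊜ (a ⊕ h ⊕ e ⊕ r ⊕ m) ⊕ b) refl A [ h ] E [ r ] L₂ A′)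
        (++⁺ʳ A′ (++⁺ˡ A (prep h (++⁺ʳ (r ∷ L₂) (↭-sym (↭-reverse E)))))))
      where
      w₃ : Walk v (A ++ [ h ]) h
      w₃ = proj₁ (cut A (subst (λ zs → Walk v zs r) (++-assoc A (h ∷ A′) [ r ]) w₁))
      ear′ : Walk h (h ∷ reverse E ++ [ r ]) r
      ear′ = subst (λ zs → Walk h zs r) (≡.trans (reverse-++ (r ∷ E) [ h ]) (cong (h ∷_) (unfold-reverse r E))) (reverseʷ ear)

  -- Degrees and the positions of neighbours along a path

  deg : V → List V → ℕ
  deg = count (adj? G)

  deg-self : ∀ u xs → deg u (u ∷ xs) ≡ deg u xs
  deg-self u xs = ≡.trans (count-++ (adj? G) u [ u ] xs)
    (cong (_+ deg u xs) (count-none (adj? G) [ u ] λ { (here refl) → irrefl G refl }))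

  last-neighbour : ∀ {u} xs → 0 < deg u xs →
    ∃₂ λ front z → ∃ λ back → xs ≡ front ++ z ∷ back × Adj G u z × deg u back ≡ 0
  last-neighbour {u} xs pos with lastHit (adj? G u) (count>0⇒Any (adj? G) xs pos)
  ... | front , z , back , eq , e , none = front , z , back , eq , e , count-none (adj? G) back none

  Sparse : V → List V → Set
  Sparse u xs = ∀ f c c′ b → xs ≡ f ++ c ∷ c′ ∷ b → Adj G u c → ¬ Adj G u c′

  Sparse-tail : ∀ {u x xs} → Sparse u (x ∷ xs) → Sparse u xs
  Sparse-tail {x = x} alone f c c′ b eq = alone (x ∷ f) c c′ b (cong (x ∷_) eq)

  -- Neighbours fill at most every other place; the extra one allows for odd length with neighbours
  -- at both ends. `sparse-next` treats the rest after a neighbour, which cannot begin with another.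
  sparse : ∀ {u} xs → Sparse u xs → 2 * deg u xs ≤ suc (length xs)
  sparse-next : ∀ {u} x xs → Adj G u x → Sparse u (x ∷ xs) → 2 * deg u xs ≤ length xs

  sparse [] _ = z≤n
  sparse {u} (x ∷ xs) alone with adj? G u x
  ... | no _ = ℕ.m≤n⇒m≤1+n (sparse xs (Sparse-tail alone))
  ... | yes e = subst (_≤ 2 + length xs) (sym (ℕ.*-suc 2 (deg u xs))) (s≤s (s≤s (sparse-next x xs e alone)))

  sparse-next x [] e _ = z≤n
  sparse-next {u} x (y ∷ ys) e alone with adj? G u y
  ... | yes e′ = contradiction e′ (alone [] x y ys refl e)
  ... | no _ = sparse ys (Sparse-tail (Sparse-tail alone))

  sparse-after : ∀ {u} s xs → s ≤ suc (length xs) →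
    (∀ f c b → xs ≡ f ++ c ∷ b → Adj G u c → s ≤ length f) →
    Sparse u xs → s + 2 * deg u xs ≤ suc (length xs)
  sparse-after zero xs _ late alone = sparse xs alone
  sparse-after (suc s) [] (s≤s z≤n) late alone = s≤s z≤n
  sparse-after {u} (suc s) (x ∷ xs) (s≤s le) late alone with adj? G u x
  ... | yes e = contradiction (late [] x xs refl e) λ ()
  ... | no _ = s≤s (sparse-after s xs le
    (λ f c b eq e → s≤s⁻¹ (late (x ∷ f) c b (cong (x ∷_) eq) e))
    (Sparse-tail alone))

  -- The 1-based position in the list of the last neighbour of u, or 0 if there is none.
  reach : V → List V → ℕ
  reach u [] = 0
  reach u (x ∷ xs) with deg u (x ∷ xs)
  ... | zero = 0
  ... | suc _ = suc (reach u xs)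

  reach-++ : ∀ u pre suf → reach u (pre ++ suf) ≤ length pre → deg u suf ≡ 0
  reach-++ u [] [] _ = refl
  reach-++ u [] (x ∷ suf) le with deg u (x ∷ suf)
  ... | zero = refl
  ... | suc _ = contradiction le λ ()
  reach-++ u (x ∷ pre) suf le with deg u (x ∷ pre ++ suf) in eq
  ... | zero = ℕ.m+n≡0⇒n≡0 (deg u (x ∷ pre)) (≡.trans (sym (count-++ (adj? G) u (x ∷ pre) suf)) eq)
  ... | suc _ = reach-++ u pre suf (s≤s⁻¹ le)

  reach≡ : ∀ u front z back → Adj G u z → deg u back ≡ 0 → reach u (front ++ z ∷ back) ≡ suc (length front)
  reach≡ u front z back e none = go front
    where
    after : ∀ back → deg u back ≡ 0 → reach u back ≡ 0
    after [] _ = refl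
    after (x ∷ back) eq with deg u (x ∷ back)
    ... | zero = refl
    go : ∀ front → reach u (front ++ z ∷ back) ≡ suc (length front)
    pos : ∀ front → deg u (front ++ z ∷ back) ≢ 0
    pos front eq = count≡0⇒¬R (adj? G) (front ++ z ∷ back) eq (∈-insert front) e
    go [] with deg u (z ∷ back) in eq
    ... | zero = contradiction eq (pos [])
    ... | suc _ = cong suc (after back none)
    go (x ∷ front) with deg u (x ∷ front ++ z ∷ back) in eq
    ... | zero = contradiction eq (pos (x ∷ front))
    ... | suc _ = cong suc (go front)

  -- For a path starting at `u`, the vertices of `T` are the ends produced by Pósa rotations: `t`
  -- becomes the end when its edge to the next vertex `c` is exchanged for the edge from `u` to `c`.
  predecessors : ∀ u x xs → ∃₂ λ T R → x ∷ xs ↭ T ++ R × length T ≡ deg u xs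
    × (∀ {t} → t ∈ T → ∃₂ λ as c → ∃ λ bs → x ∷ xs ≡ as ++ t ∷ c ∷ bs × Adj G u c)
  predecessors u x [] = [] , [ x ] , refl , refl , λ ()
  predecessors u x (y ∷ ys) with predecessors u y ys | adj? G u y
  ... | T , R , p , len , pred | yes e = x ∷ T , R , prep x p , cong suc len ,
    λ { (here refl) → [] , y , ys , refl , e
      ; (there t∈) → let as , c , bs , eq , e′ = pred t∈ in x ∷ as , c , bs , cong (x ∷_) eq , e′ }
  ... | T , R , p , len , pred | no _ = T , x ∷ R , trans (prep x p) (↭-sym (shift x T R)) , len ,
    λ t∈ → let as , c , bs , eq , e′ = pred t∈ in x ∷ as , c , bs , cong (x ∷_) eq , e′

  nonempty : ∀ {a xs b} → Walk a xs b → ∃ λ m → length xs ≡ suc m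
  nonempty [-] = 0 , refl
  nonempty (_∷_ {xs = xs} _ _) = length xs , refl

  splitAt-length : ∀ j (xs : List V) → j ≤ length xs → ∃₂ λ pre suf → xs ≡ pre ++ suf × length pre ≡ j
  splitAt-length j xs le = take j xs , drop j xs , sym (take++drop≡id j xs)
    , ≡.trans (length-take j xs) (ℕ.m≤n⇒m⊓n≡m le)

  -- The long cycle through the vertex of high degree

  module LongCycle {U : List V} (uU : Unique U) (K : ℕ) (2≤K : 2 ≤ K) {v : V} (v∈U : v ∈ U)
    -- The sum is twice the number of edges that meet `S`: an edge inside `S` counts once at each
    -- end, an edge between `S` and `R` counts twice at its end in `S`.
    (removal : ∀ S R → U ↭ S ++ R → 0 < length S → 0 < length R →
               length S * K < sum (map (λ u → deg u U + deg u R) S))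
    (connected : ∀ z A C → U ↭ z ∷ A ++ C → ∀ {a c} → a ∈ A → c ∈ C →
                 ∃₂ λ a c → a ∈ A × c ∈ C × Adj G a c)
    (K≤deg : K ≤ deg v U)
    -- This is the assumption that `absurd` refutes.
    (short : ∀ {xs} → IsCycle U v xs → length xs ≤ K)
    where

    IsPath₁ : List V → Set
    IsPath₁ ps = (∃ λ e → Walk v (v ∷ ps) e) × Unique (v ∷ ps) × (v ∷ ps) ⊆ U

    -- This is `removal` for a single vertex: all neighbours of `u` lie in `R`, so its degree is
    -- counted twice. The vertex `v` makes `R` nonempty.
    K<2deg : ∀ {u} → u ∈ U → u ≢ v → K < 2 * deg u U
    K<2deg {u} u∈ u≢v with complement {xs = [ u ]} ([] ∷ []) (λ { (here refl) → u∈ })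
    ... | R , p = begin-strict
      K                              ≡⟨ ℕ.*-identityˡ K ⟨
      1 * K                          <⟨ removal [ u ] R p z<s R>0 ⟩
      deg u U + deg u R + 0          ≡⟨ ℕ.+-identityʳ _ ⟩
      deg u U + deg u R              ≡⟨ cong (deg u U +_) (≡.trans (sym (deg-self u R)) (sym (count-↭ (adj? G) u p))) ⟩
      deg u U + deg u U              ≡⟨ cong (deg u U +_) (ℕ.+-identityʳ _) ⟨
      2 * deg u U                    ∎
      where
      open ℕ.≤-Reasoning
      R>0 : 0 < length R
      R>0 with ∈-resp-↭ p v∈U
      ... | here v≡u = contradiction (sym v≡u) u≢v
      ... | there v∈R = ∈-length v∈R

    0<deg : ∀ {u} → u ∈ U → u ≢ v → 0 < deg u U
    0<deg u∈ u≢v = ℕ.*-cancelˡ-< 2 0 _ (ℕ.≤-<-trans z≤n (K<2deg u∈ u≢v))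

    module Longest {ps : List V} (path₁ : IsPath₁ ps) (longest : ∀ {qs} → IsPath₁ qs → length qs ≤ length ps) where

      open Detours U v ps
      open Detour

      v∉ps : v ∉ ps
      v∉ps = Unique.Unique[x∷xs]⇒x∉xs (proj₁ (proj₂ path₁))

      unique-ps : Unique ps
      unique-ps = proj₁ (proj₂ (Unique-++⁻ [ v ] (proj₁ (proj₂ path₁))))

      ps⊆U : ps ⊆ U
      ps⊆U = proj₂ (proj₂ path₁) ∘ there

      initial : ∀ front {p back} → ps ≡ front ++ p ∷ back →
                (∃ λ y → Walk p (reverse (front ++ [ p ])) y × Adj G y v) × ∃ λ e → Walk p (p ∷ back) e
      initial front {p} {back} refl with proj₁ path₁
      ... | e , w with cut (v ∷ front) w
      ... | w₁ , w₂ = backwards front w₁ , e , w₂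
        where
        backwards : ∀ front → Walk v (v ∷ front ++ [ p ]) p → ∃ λ y → Walk p (reverse (front ++ [ p ])) y × Adj G y v
        backwards [] (a ∷ w) with start≡ w
        ... | refl = p , [-] , symm G a
        backwards (y ∷ front) (a ∷ w) with start≡ w
        ... | refl = y , reverseʷ w , symm G a

      -- From `p` the longest path is followed back to its first vertex after `v`, whose edge to `v`
      -- closes the cycle.
      detour-cycle : ∀ {L p front back} → Detour L p → ps ≡ front ++ p ∷ back →
                     IsCycle U v (L ++ p ∷ reverse front)
      detour-cycle {L} {p} {front} {back} D eq with proj₁ (initial front eq)
      ... | y , w , a = (y , join L (walk D) w′ , a)
        , Unique.++⁺ (unique D) unique′ (λ (x∈L , x∈) → avoids D x∈L (inside x∈))
        , λ x∈ → [ within D , ps⊆U ∘ inside ]′ (∈-++⁻ L x∈)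
        where
        w′ : Walk p (p ∷ reverse front) y
        w′ = subst (λ zs → Walk p zs y) (reverse-++ front [ p ]) w
        perm : front ++ [ p ] ↭ p ∷ reverse front
        perm = trans (++-comm front [ p ]) (prep p (↭-sym (↭-reverse front)))
        unique′ : Unique (p ∷ reverse front)
        unique′ = Unique-resp-↭ perm (Unique-++⁻ˡ (front ++ [ p ])
          (subst Unique (≡.trans eq (sym (++-assoc front [ p ] back))) unique-ps))
        inside : ∀ {x} → x ∈ p ∷ reverse front → x ∈ ps
        inside x∈ = subst (_ ∈_) (sym (≡.trans eq (sym (++-assoc front [ p ] back)))) (∈-++⁺ˡ (∈-resp-↭ (↭-sym perm) x∈))

      -- Otherwise replacing front by L would lengthen the longest path v ∷ ps.
      detour-length : ∀ {L p front back} → Detour L p → ps ≡ front ++ p ∷ back → length L ≤ suc (length front)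
      detour-length {[]} D eq = z≤n
      detour-length {x ∷ X} {p} {front} {back} D eq with start≡ (walk D) | initial front eq
      ... | refl | _ , e , w = s≤s (ℕ.+-cancelʳ-≤ (suc (length back)) _ _ (subst₂ _≤_
        (length-++ X) (≡.trans (cong length eq) (length-++ front))
        (longest {X ++ p ∷ back} ((e , join (v ∷ X) (walk D) w)
        , Unique.++⁺ (unique D) unique′ (λ (x∈L , x∈) → avoids D x∈L (inside x∈))
        , λ x∈ → [ within D , ps⊆U ∘ inside ]′ (∈-++⁻ (v ∷ X) x∈)))))
        where
        unique′ : Unique (p ∷ back)
        unique′ = proj₁ (proj₂ (Unique-++⁻ front (subst Unique eq unique-ps)))
        inside : ∀ {x} → x ∈ p ∷ back → x ∈ ps
        inside x∈ = subst (_ ∈_) (sym eq) (∈-++⁺ʳ front x∈)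

      -- By `detour-length` the part of `ps` up to `p` is at least as long as `L`. Both together
      -- form a cycle through `v`, which is `short`.
      detour-short : ∀ {L p} → Detour L p → 2 * length L ≤ K
      detour-short {L} {p} D with ∈-∃++ (end∈ps D)
      ... | front , back , eq = begin
        2 * length L                               ≡⟨ cong (length L +_) (ℕ.+-identityʳ _) ⟩
        length L + length L                        ≤⟨ ℕ.+-monoʳ-≤ (length L) (detour-length D eq) ⟩
        length L + suc (length front)              ≡⟨ cong (λ k → length L + suc k) (length-reverse front) ⟨
        length L + length (p ∷ reverse front)      ≡⟨ length-++ L ⟨
        length (L ++ p ∷ reverse front)            ≤⟨ short (detour-cycle D eq) ⟩
        K                                          ∎
        where open ℕ.≤-Reasoning

      connect : ∀ z {w b} → z ∈ U → w ∈ U → w ≢ z → b ∈ U → b ≢ z → ∀ L → b ∈ L ⊎ b ∈ ps →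
        ∃₂ λ W h → Walk w (W ++ [ h ]) h × Unique (W ++ [ h ]) × (W ++ [ h ]) ⊆ U × z ∉ W ++ [ h ]
                 × (h ∈ L ⊎ h ∈ ps) × (∀ {x} → x ∈ W → ¬ (x ∈ L ⊎ x ∈ ps))
      connect z z∈ w∈ w≢z b∈ b≢z L Bb =
        separates⇒path uU z (connected z) (λ x → (x ∈? L) ⊎-dec (x ∈? ps)) z∈ w∈ w≢z b∈ b≢z Bb

      -- Induction along the walk. If the next vertex `z′` is on a detour that misses `z`, a path
      -- from `z` avoiding `z′` leads to that detour or to `ps`. With the edge from `z′` to `z` it
      -- is an ear, which `absorb` builds in.
      detour-through : ∀ {z zs p₀} → Walk z zs v → zs ⊆ U → All (_∉ ps) zs → p₀ ∈ ps →
                       ∃₂ λ L p → Detour L p × z ∈ L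
      detour-through [-] _ _ p₀∈ = first (proj₁ path₁) p₀∈ (λ x∈ → x∈)
        where
        first : ∀ {qs p₀} → (∃ λ e → Walk v (v ∷ qs) e) → p₀ ∈ qs → qs ⊆ ps → ∃₂ λ L p → Detour L p × v ∈ L
        first {q ∷ _} (_ , a ∷ w) _ qs⊆ with start≡ w
        ... | refl = [ v ] , q , detour (a ∷ [-]) (qs⊆ (here refl)) ([] ∷ []) (λ { (here refl) → v∉ps })
          (λ { (here refl) → v∈U }) , here refl
      detour-through {z} (_∷_ {b = z′} a w) zs⊆ (z∉ps ∷ ∉ps) p₀∈
        with detour-through w (zs⊆ ∘ there) ∉ps p₀∈
      ... | L , p , D , z′∈L with z ∈? L
      ... | yes z∈L = L , p , D , z∈L
      ... | no z∉L with connect z′ (within D z′∈L) (zs⊆ (here refl)) (λ { refl → z∉L z′∈L }) (ps⊆U (end∈ps D))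
                          (λ { refl → avoids D z′∈L (end∈ps D) }) L (inj₂ (end∈ps D))
      ... | W , h , walkW , uW , W⊆ , z′∉ , target , none
        with absorb D z′∈L (symm G a ∷ walkW) (Unique-++⁻ˡ W uW) (λ x∈ x∈L → none x∈ (inj₁ x∈L))
               (λ x∈ x∈ps → none x∈ (inj₂ x∈ps)) (W⊆ ∘ ∈-++⁺ˡ) target (λ { refl → z′∉ (∈-insert W) })
      ... | L′ , p′ , D′ , ⊆L′ = L′ , p′ , D′ , ⊆L′ (there z∈W)
        where
        z∈W : z ∈ W
        z∈W with ∈-++⁻ W (start∈ walkW)
        ... | inj₁ z∈ = z∈
        ... | inj₂ (here refl) = contradiction target [ z∉L , z∉ps ]′

      -- Long cycles disjoint from the longest path

      module _ {a Q} (cyc : IsCycle U a Q) (Q∉ps : ∀ {x} → x ∈ Q → x ∉ ps) (K<Q : K < length Q) where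

        private
          Q⊆U : Q ⊆ U
          Q⊆U = proj₂ (proj₂ cyc)

          too-long : ∀ {L p A} → Detour L p → length Q ≤ 2 * suc A → suc A ≤ length L → ⊥
          too-long {L} {A = A} D le₁ le₂ = ℕ.<-irrefl refl (begin-strict
            K             <⟨ K<Q ⟩
            length Q      ≤⟨ le₁ ⟩
            2 * suc A     ≤⟨ ℕ.*-monoʳ-≤ 2 le₂ ⟩
            2 * length L  ≤⟨ detour-short D ⟩
            K             ∎)
            where open ℕ.≤-Reasoning

        -- Between its first and last vertex on `Q` the detour can be redirected along the larger
        -- arc of `Q`. It then covers half of `Q`, against `detour-short`.
        no-two-hits : ∀ L₁ {q} M {q′} L₂ {p} → Detour (L₁ ++ q ∷ M ++ q′ ∷ L₂) p → q ∈ Q → q′ ∈ Q →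
                   (∀ {x} → x ∈ L₁ → x ∉ Q) → (∀ {x} → x ∈ L₂ → x ∉ Q) → ⊥
        no-two-hits L₁ {q} M {q′} L₂ {p} D q∈ q′∈ none₁ none₂ with arc U cyc q∈ q′∈ q≢q′
          where
          q≢q′ : q ≢ q′
          q≢q′ refl = Unique.Unique[x∷xs]⇒x∉xs (proj₁ (proj₂ (Unique-++⁻ L₁ (unique D)))) (∈-insert M)
        ... | A , walkA , uA , A⊆ , le = too-long D′ le (begin
          suc (length A)              ≤⟨ s≤s (subst (length A ≤_) (sym (length-++ A)) (ℕ.m≤m+n _ _)) ⟩
          length (q ∷ A ++ q′ ∷ L₂)   ≤⟨ subst (_ ≤_) (sym (length-++ L₁)) (ℕ.m≤n+m _ (length L₁)) ⟩
          length L′                   ∎)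
          where
          open ℕ.≤-Reasoning
          L′ = L₁ ++ q ∷ A ++ q′ ∷ L₂
          pieces : L₁ ++ q ∷ M ++ q′ ∷ L₂ ↭ (L₁ ++ L₂) ++ q ∷ M ++ [ q′ ]
          pieces = solve 5 (λ l q m q′ l′ → l ⊕ q ⊕ m ⊕ q′ ⊕ l′ ⊜ (l ⊕ l′) ⊕ q ⊕ m ⊕ q′) refl L₁ [ q ] M [ q′ ] L₂
          pieces′ : (L₁ ++ L₂) ++ (q ∷ A ++ [ q′ ]) ↭ L′
          pieces′ = solve 5 (λ l q m q′ l′ → (l ⊕ l′) ⊕ q ⊕ m ⊕ q′ ⊜ l ⊕ q ⊕ m ⊕ q′ ⊕ l′) refl L₁ [ q ] A [ q′ ] L₂
          old : (L₁ ++ L₂) ⊆ (L₁ ++ q ∷ M ++ q′ ∷ L₂)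
          old x∈ = ∈-resp-↭ (↭-sym pieces) (∈-++⁺ˡ x∈)
          split : ∀ {x} → x ∈ L′ → x ∈ L₁ ++ L₂ ⊎ x ∈ Q
          split x∈ = Sum.map₂ A⊆ (∈-++⁻ (L₁ ++ L₂) (∈-resp-↭ (↭-sym pieces′) x∈))
          walk′ : Walk v (L′ ++ [ p ]) p
          walk′ with cut L₁ (subst (λ zs → Walk v zs p) (++-assoc L₁ (q ∷ M ++ q′ ∷ L₂) [ p ]) (walk D))
          ... | w₁ , w₂ with cut (q ∷ M) (subst (λ zs → Walk q (q ∷ zs) p) (++-assoc M (q′ ∷ L₂) [ p ]) w₂)
          ... | _ , w₃ = subst (λ zs → Walk v zs p)
            (sym (≡.trans (++-assoc L₁ (q ∷ A ++ q′ ∷ L₂) [ p ])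
              (cong (λ zs → L₁ ++ q ∷ zs) (++-assoc A (q′ ∷ L₂) [ p ]))))
            (join L₁ w₁ (join (q ∷ A) walkA w₃))
          D′ : Detour L′ p
          D′ = detour walk′ (end∈ps D)
            (Unique-resp-↭ pieces′ (Unique.++⁺ (Unique-++⁻ˡ (L₁ ++ L₂) (Unique-resp-↭ pieces (unique D))) uA
              λ (x∈ , x∈A) → [ none₁ , none₂ ]′ (∈-++⁻ L₁ x∈) (A⊆ x∈A)))
            (λ x∈ → [ avoids D ∘ old , Q∉ps ]′ (split x∈)) (λ x∈ → [ within D ∘ old , Q⊆U ]′ (split x∈))

        -- Another vertex `y` of `Q` has a path to the detour or to `ps` that avoids `q`. The larger
        -- arc from `q` to the last vertex of `Q` on that path, continued by the rest of the path,
        -- is an ear. Absorbing it makes the detour too long.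
        no-one-hit : ∀ {L q p} → Detour L p → q ∈ L → q ∈ Q → (∀ {x} → x ∈ L → x ∈ Q → x ≡ q) → ⊥
        no-one-hit {L} {q} {p} D q∈L q∈Q only with complement {xs = [ q ]} ([] ∷ []) (λ { (here refl) → q∈Q })
        -- Here `Q` would be the single vertex `q`; `2≤K` unfolds to `1 < K`.
        ... | [] , π = ℕ.<⇒≱ (ℕ.<-trans 2≤K K<Q) (subst (length Q ≤_) (↭-length π) ℕ.≤-refl)
        ... | y ∷ ys , π with connect q (within D q∈L) (Q⊆U y∈Q) y≢q (ps⊆U (end∈ps D))
                                (λ { refl → avoids D q∈L (end∈ps D) }) L (inj₂ (end∈ps D))
          where
          y∈Q : y ∈ Q
          y∈Q = ∈-resp-↭ (↭-sym π) (there (here refl))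
          y≢q : y ≢ q
          y≢q refl = Unique.Unique[x∷xs]⇒x∉xs (Unique-resp-↭ π (proj₁ (proj₂ cyc))) (here refl)
        ... | W , h , walkW , uW , W⊆ , q∉ , target , none
          with lastHit (_∈? Q) (lose y∈W (∈-resp-↭ (↭-sym π) (there (here refl))))
          where
          y∈W : y ∈ W
          y∈W with ∈-++⁻ W (start∈ walkW)
          ... | inj₁ y∈ = y∈
          ... | inj₂ (here refl) = contradiction target
            [ (λ y∈L → q∉ (subst (_∈ W ++ [ y ]) (only y∈L (∈-resp-↭ (↭-sym π) (there (here refl)))) (∈-insert W)))
            , Q∉ps (∈-resp-↭ (↭-sym π) (there (here refl))) ]′
        ... | W₁ , q′ , W₂ , refl , q′∈Q , none₂ with arc U cyc q∈Q q′∈Q (λ { refl → q∉ (∈-++⁺ˡ (∈-insert W₁)) })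
        ... | A , walkA , uA , A⊆ , le
          with absorb D q∈L ear uE E∩L E∩ps E⊆U target (λ { refl → q∉ (∈-insert (W₁ ++ q′ ∷ W₂)) })
          where
          E = A ++ q′ ∷ W₂
          E≡ : (A ++ [ q′ ]) ++ W₂ ≡ E
          E≡ = ++-assoc A [ q′ ] W₂
          W₂⊆W : W₂ ⊆ W₁ ++ q′ ∷ W₂
          W₂⊆W x∈ = ∈-++⁺ʳ W₁ (there x∈)
          split : ∀ {x} → x ∈ E → x ∈ A ++ [ q′ ] ⊎ x ∈ W₂
          split x∈ = ∈-++⁻ (A ++ [ q′ ]) (subst (_ ∈_) (sym E≡) x∈)
          ear : Walk q (q ∷ E ++ [ h ]) h
          ear = subst (λ zs → Walk q (q ∷ zs) h) (sym (++-assoc A (q′ ∷ W₂) [ h ]))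
            (join (q ∷ A) walkA (proj₂ (cut W₁ (subst (λ zs → Walk y zs h) (++-assoc W₁ (q′ ∷ W₂) [ h ]) walkW))))
          uW₂ : Unique W₂
          uW₂ = proj₁ (proj₂ (Unique-++⁻ [ q′ ] (proj₁ (proj₂ (Unique-++⁻ W₁ (Unique-++⁻ˡ (W₁ ++ q′ ∷ W₂) uW))))))
          uE : Unique E
          uE = subst Unique E≡ (Unique.++⁺ (proj₁ (proj₂ (Unique-++⁻ [ q ] uA))) uW₂ λ (x∈ , x∈W₂) → none₂ x∈W₂ (A⊆ (there x∈)))
          E∩L : ∀ {x} → x ∈ E → x ∉ L
          E∩L x∈ x∈L with split x∈
          ... | inj₂ x∈W₂ = none (W₂⊆W x∈W₂) (inj₁ x∈L)
          ... | inj₁ x∈A with only x∈L (A⊆ (there x∈A))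
          ... | refl = Unique.Unique[x∷xs]⇒x∉xs uA x∈A
          E∩ps : ∀ {x} → x ∈ E → x ∉ ps
          E∩ps x∈ x∈ps = [ (λ x∈A → Q∉ps (A⊆ (there x∈A)) x∈ps) , (λ x∈W₂ → none (W₂⊆W x∈W₂) (inj₂ x∈ps)) ]′ (split x∈)
          E⊆U : E ⊆ U
          E⊆U x∈ = [ Q⊆U ∘ A⊆ ∘ there , W⊆ ∘ ∈-++⁺ˡ ∘ W₂⊆W ]′ (split x∈)
        ... | L′ , p′ , D′ , ⊆L′ = too-long D′ le (Unique-⊆⇒length≤ (Unique-++⁻ˡ (q ∷ A) uA)
          (λ x∈ → ⊆L′ (∈-++⁺ˡ x∈)))

        no-detour-meets-cycle : ∀ {L p z} → Detour L p → z ∈ L → z ∈ Q → ⊥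
        no-detour-meets-cycle {L} D z∈L z∈Q with firstHit (_∈? Q) (lose z∈L z∈Q)
        ... | L₁ , q , L₂ , refl , q∈Q , none₁ with any? (_∈? Q) L₂
        ... | no ¬h = no-one-hit D (∈-insert L₁) q∈Q only
          where
          only : ∀ {x} → x ∈ L₁ ++ q ∷ L₂ → x ∈ Q → x ≡ q
          only x∈ x∈Q with ∈-++⁻ L₁ x∈
          ... | inj₁ x∈L₁ = contradiction x∈Q (none₁ x∈L₁)
          ... | inj₂ (here eq) = eq
          ... | inj₂ (there x∈L₂) = contradiction (lose x∈L₂ x∈Q) ¬h
        ... | yes h with lastHit (_∈? Q) h
        ... | M , q′ , L₃ , refl , q′∈Q , none₂ = no-two-hits L₁ M L₃ D q∈Q q′∈Q none₁ none₂

      -- Otherwise inserting `u` between `c` and `c′` would lengthen the longest path.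
      no-insertion : ∀ {u} f {c c′ r} → ps ≡ f ++ c ∷ c′ ∷ r → u ∈ U → u ∉ v ∷ ps → Adj G u c → ¬ Adj G u c′
      no-insertion {u} f {c} {c′} {r} refl u∈U u∉ a a′ with proj₁ path₁
      ... | e , w with cut (v ∷ f) w
      ... | w₁ , _ ∷ w₂ with start≡ w₂
      ... | refl = ℕ.<⇒≱ (ℕ.≤-reflexive (↭-length perm))
          (longest {f ++ c ∷ u ∷ c′ ∷ r} ((e , join (v ∷ f) w₁ (symm G a ∷ a′ ∷ w₂))
            , Unique-resp-↭ perm′ (∉⇒Unique-∷ u∉ (proj₁ (proj₂ path₁)))
            , λ x∈ → u∷⊆U (∈-resp-↭ (↭-sym perm′) x∈)))
        where
        perm : u ∷ f ++ c ∷ c′ ∷ r ↭ f ++ c ∷ u ∷ c′ ∷ r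
        perm = trans (↭-sym (shift u f (c ∷ c′ ∷ r))) (++⁺ˡ f (swap u c refl))
        perm′ : u ∷ v ∷ f ++ c ∷ c′ ∷ r ↭ v ∷ f ++ c ∷ u ∷ c′ ∷ r
        perm′ = trans (swap u v refl) (prep v perm)
        u∷⊆U : u ∷ v ∷ ps ⊆ U
        u∷⊆U (here refl) = u∈U
        u∷⊆U (there x∈) = proj₂ (proj₂ path₁) x∈

      -- Listed from the free end towards v.
      IsPath₂ : List V → Set
      IsPath₂ xs = (∃ λ u → Walk u xs v) × Unique xs × xs ⊆ U × All (_∉ ps) xs

      isPath₂? : ∀ xs → Dec (IsPath₂ xs)
      isPath₂? xs = Fin.any? (λ u → walk? u xs v) ×-dec unique? _≟_ xs ×-dec (xs ⊆? U)
        ×-dec All.all? (λ x → ¬? (x ∈? ps)) xs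

      -- Longest paths that avoid the first one, and their rotations

      module Maximal {s} (2≤s : 2 ≤ s) (maximal₂ : ∀ {xs} → IsPath₂ xs → length xs ≤ s) where

        end≢start : ∀ {u xs} → Walk u xs v → Unique xs → s ≤ length xs → u ≢ v
        end≢start [-] _ s≤ = contradiction (ℕ.≤-trans 2≤s s≤) λ { (s≤s ()) }
        end≢start (_ ∷ w) u _ refl = Unique.Unique[x∷xs]⇒x∉xs u (end∈ w)

        -- Otherwise `y` would prolong the path at its free end.
        end-saturated : ∀ {u xs y} → Walk u xs v → IsPath₂ xs → s ≤ length xs →
                        y ∈ U → y ∉ xs → y ∉ ps → ¬ Adj G u y
        end-saturated w (_ , uxs , xs⊆ , ∉ps) s≤ y∈U y∉xs y∉ps a =
          ℕ.<⇒≱ (s≤s s≤) (maximal₂ ((_ , symm G a ∷ w) , ∉⇒Unique-∷ y∉xs uxs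
            , (λ { (here refl) → y∈U ; (there x∈) → xs⊆ x∈ }) , y∉ps ∷ ∉ps))

        -- Let `z` be the last neighbour of `u` on `ps`, and let `xs` have `m + 1` vertices. At most
        -- `m` neighbours lie on `xs`; those on `ps` come after at least `m` vertices and are never
        -- consecutive. By `K<2deg` and `sparse-after` the detour along `xs` to `z` yields a cycle
        -- with more than `K` vertices.
        avoids-ps : ∀ {u xs p} → Walk u xs v → IsPath₂ xs → s ≤ length xs → p ∈ ps → ¬ Adj G u p
        avoids-ps {u} {xs} {p} w P@(_ , uxs , xs⊆ , ∉ps) s≤ p∈ a
          with last-neighbour ps (filter-some (adj? G u) (lose p∈ a)) | nonempty w
        ... | front , z , back , eq , e , none | m , len =
          ℕ.<⇒≱ long (short (detour-cycle (reversed (subst (_ ∈_) (sym eq) (∈-insert front)) e) eq))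
          where
          reversed : ∀ {q} → q ∈ ps → Adj G u q → Detour (reverse xs) q
          reversed q∈ a′ = detour (link (reverseʷ w) a′ [-]) q∈ (Unique-resp-↭ (↭-sym (↭-reverse xs)) uxs)
            (λ x∈ → All.lookup ∉ps (∈-resp-↭ (↭-reverse xs) x∈)) (λ x∈ → xs⊆ (∈-resp-↭ (↭-reverse xs) x∈))

          eq′ : ∀ {bs} → front ++ [ z ] ≡ bs → ps ≡ bs ++ back
          eq′ refl = ≡.trans eq (sym (++-assoc front [ z ] back))

          -- The reversed path is a detour to `c`, so `detour-length` applies with `f` as the
          -- initial part of `ps`.
          late : ∀ f c b → front ++ [ z ] ≡ f ++ c ∷ b → Adj G u c → m ≤ length f
          late f c b split a′ = s≤s⁻¹ (subst (_≤ suc (length f)) (≡.trans (length-reverse xs) len)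
            (detour-length (reversed (subst (c ∈_) (sym ps≡) (∈-insert f)) a′) ps≡))
            where
            ps≡ : ps ≡ f ++ c ∷ b ++ back
            ps≡ = ≡.trans (eq′ split) (++-assoc f (c ∷ b) back)

          alone : Sparse u (front ++ [ z ])
          alone f c c′ b split = no-insertion f (≡.trans (eq′ split) (++-assoc f (c ∷ c′ ∷ b) back)) (xs⊆ (start∈ w))
            λ { (here u≡v) → end≢start w uxs s≤ u≡v ; (there u∈) → All.lookup ∉ps (start∈ w) u∈ }

          deg-xs : deg u xs ≤ m
          deg-xs = s≤s⁻¹ (subst (deg u xs <_) len (filter-notAll (adj? G u) xs (lose (start∈ w) (irrefl G refl))))

          deg-U : deg u U ≡ deg u xs + deg u (front ++ [ z ])
          deg-U with complement {xs = xs ++ ps} (Unique.++⁺ uxs unique-ps λ (x∈ , x∈ps) → All.lookup ∉ps x∈ x∈ps)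
                                ([ xs⊆ , ps⊆U ]′ ∘ ∈-++⁻ xs)
          ... | O , p = begin
            deg u U                               ≡⟨ count-↭ (adj? G) u p ⟩
            deg u ((xs ++ ps) ++ O)               ≡⟨ count-++ (adj? G) u (xs ++ ps) O ⟩
            deg u (xs ++ ps) + deg u O            ≡⟨ cong (deg u (xs ++ ps) +_) (count-none (adj? G) O outside) ⟩
            deg u (xs ++ ps) + 0                  ≡⟨ ℕ.+-identityʳ _ ⟩
            deg u (xs ++ ps)                      ≡⟨ count-++ (adj? G) u xs ps ⟩
            deg u xs + deg u ps                   ≡⟨ cong (λ zs → deg u xs + deg u zs) (eq′ refl) ⟩
            deg u xs + deg u ((front ++ [ z ]) ++ back)
              ≡⟨ cong (deg u xs +_) (count-++ (adj? G) u (front ++ [ z ]) back) ⟩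
            deg u xs + (deg u (front ++ [ z ]) + deg u back)
              ≡⟨ cong (λ k → deg u xs + (deg u (front ++ [ z ]) + k)) none ⟩
            deg u xs + (deg u (front ++ [ z ]) + 0)
              ≡⟨ cong (deg u xs +_) (ℕ.+-identityʳ _) ⟩
            deg u xs + deg u (front ++ [ z ])     ∎
            where
            open ≡-Reasoning
            outside : ∀ {y} → y ∈ O → ¬ Adj G u y
            outside y∈ = end-saturated w P s≤ (∈-resp-↭ (↭-sym p) (∈-++⁺ʳ (xs ++ ps) y∈))
              (λ y∈xs → disj (∈-++⁺ˡ y∈xs) y∈) (λ y∈ps → disj (∈-++⁺ʳ xs y∈ps) y∈)
              where
              disj : ∀ {y} → y ∈ xs ++ ps → y ∉ O
              disj = proj₂ (proj₂ (Unique-++⁻ (xs ++ ps) (Unique-resp-↭ p uU)))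

          long : K < length (reverse xs ++ z ∷ reverse front)
          long = begin-strict
            K                                            <⟨ K<2deg (xs⊆ (start∈ w)) (end≢start w uxs s≤) ⟩
            2 * deg u U                                  ≡⟨ cong (2 *_) deg-U ⟩
            2 * (deg u xs + dz)                          ≤⟨ ℕ.*-monoʳ-≤ 2 (ℕ.+-monoˡ-≤ dz deg-xs) ⟩
            2 * (m + dz)                                 ≡⟨ double m dz ⟩
            m + (m + 2 * dz)                             ≤⟨ ℕ.+-monoʳ-≤ m (sparse-after m (front ++ [ z ]) m≤ late alone) ⟩
            m + suc (length (front ++ [ z ]))            ≡⟨ cong (λ k → m + suc k) (↭-length (++-comm front [ z ])) ⟩
            m + suc (suc (length front))                 ≡⟨ ℕ.+-suc m _ ⟩
            suc m + suc (length front)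
              ≡⟨ cong₂ (λ k l → k + suc l) (≡.trans (length-reverse xs) len) (length-reverse front) ⟨
            length (reverse xs) + length (z ∷ reverse front)  ≡⟨ length-++ (reverse xs) ⟨
            length (reverse xs ++ z ∷ reverse front)     ∎
            where
            open ℕ.≤-Reasoning
            dz = deg u (front ++ [ z ])
            double : ∀ m d → 2 * (m + d) ≡ m + (m + 2 * d)
            double = solve-∀
            m≤ : m ≤ suc (length (front ++ [ z ]))
            m≤ = ℕ.m≤n⇒m≤1+n (ℕ.≤-trans (late front z [] refl e) (subst (length front ≤_) (sym (length-++ front)) (ℕ.m≤m+n _ 1)))

        Longest₂ : List V → Set
        Longest₂ xs = IsPath₂ xs × s ≤ length xs

        deg-U≡ : ∀ {u xs} → Walk u xs v → Longest₂ xs → deg u U ≡ deg u xs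
        deg-U≡ {u} {xs} w (P@(_ , uxs , xs⊆ , _) , s≤) with complement uxs xs⊆
        ... | O , p = begin
          deg u U               ≡⟨ count-↭ (adj? G) u p ⟩
          deg u (xs ++ O)       ≡⟨ count-++ (adj? G) u xs O ⟩
          deg u xs + deg u O    ≡⟨ cong (deg u xs +_) (count-none (adj? G) O outside) ⟩
          deg u xs + 0          ≡⟨ ℕ.+-identityʳ _ ⟩
          deg u xs              ∎
          where
          open ≡-Reasoning
          outside : ∀ {y} → y ∈ O → ¬ Adj G u y
          outside {y} y∈ with y ∈? ps
          ... | yes y∈ps = avoids-ps w P s≤ y∈ps
          ... | no y∉ps = end-saturated w P s≤ (∈-resp-↭ (↭-sym p) (∈-++⁺ʳ xs y∈))
            (λ y∈xs → proj₂ (proj₂ (Unique-++⁻ xs (Unique-resp-↭ p uU))) y∈xs y∈) y∉ps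

        -- `maximal` takes a measure of bare lists, so the free end of a path is read off as the
        -- head of its list.
        onHead : (V → List V → ℕ) → List V → ℕ
        onHead f [] = 0
        onHead f (x ∷ xs) = f x (x ∷ xs)

        onHead≡ : ∀ f {u xs} → Walk u xs v → onHead f xs ≡ f u xs
        onHead≡ f [-] = refl
        onHead≡ f (_ ∷ _) = refl

        -- The Pósa rotation: the initial part from `u` to `t` is reversed and `u` is joined to `c`.
        -- The vertex set stays the same.
        rotate₂ : ∀ {u} as {t c r} → Longest₂ (as ++ t ∷ c ∷ r) → Walk u (as ++ t ∷ c ∷ r) v → Adj G u c →
                  Walk t (reverse (as ++ [ t ]) ++ c ∷ r) v × Longest₂ (reverse (as ++ [ t ]) ++ c ∷ r)
        rotate₂ {u} as {t} {c} {r} ((_ , uxs , xs⊆ , ∉ps) , s≤) w a with cut as w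
        ... | w₁ , (_ ∷ w₂) with start≡ w₂
        ... | refl = w′ , ((t , w′) , Unique-resp-↭ perm uxs , xs⊆ ∘ ∈-resp-↭ (↭-sym perm) , All-resp-↭ perm ∉ps)
                   , subst (s ≤_) (↭-length perm) s≤
          where
          w′ : Walk t (reverse (as ++ [ t ]) ++ c ∷ r) v
          w′ = link (reverseʷ w₁) a w₂
          perm : as ++ t ∷ c ∷ r ↭ reverse (as ++ [ t ]) ++ c ∷ r
          perm = trans (↭-reflexive (sym (++-assoc as [ t ] (c ∷ r)))) (++⁺ʳ (c ∷ r) (↭-sym (↭-reverse (as ++ [ t ]))))

        -- The predecessors T of the neighbours of the end u are ends of rotated paths, so their
        -- degrees are at most deg u = |T| and their neighbours lie among the first j vertices.
        K<reach : ∀ {j} → 0 < j → j ≤ s → (∀ {xs} → Longest₂ xs → onHead reach xs ≤ j) →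
          ∀ {xs} → Longest₂ xs →
          (∀ {ys} → Longest₂ ys → onHead (λ u _ → deg u U) ys ≤ onHead (λ u _ → deg u U) xs) → K < j
        K<reach {j} 0<j j≤s reach≤ {xs} P@(((u , w) , uxs , xs⊆ , _) , s≤) deg≤ =
          bound (splitAt-length j xs (ℕ.≤-trans j≤s s≤))
          where
          bound : (∃₂ λ pre suf → xs ≡ pre ++ suf × length pre ≡ j) → K < j
          bound ([] , _ , _ , refl) = contradiction 0<j λ ()
          bound (x ∷ pre , suf , refl , len) with start≡ w
          ... | refl with predecessors u u pre | complement uxs xs⊆
          ... | T , R , p , lenT , pred | O , q = ℕ.*-cancelˡ-< (length T) K j (begin-strict
            length T * K                                        <⟨ removal T R′ π T>0 R′>0 ⟩
            sum (map (λ t → deg t U + deg t R′) T)              ≤⟨ sum-map-≤ T each ⟩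
            sum (map (λ _ → length T + length R) T)             ≡⟨ sum-map-const _ T ⟩
            length T * (length T + length R)                    ≡⟨ cong (length T *_) T+R ⟩
            length T * j                                        ∎)
            where
            open ℕ.≤-Reasoning
            -- All of `U` outside `T`: the other vertices among the first `j`, the rest of the path,
            -- and the vertices off the path.
            R′ = R ++ suf ++ O
            T+R : length T + length R ≡ j
            T+R = ≡.trans (sym (length-++ T)) (≡.trans (sym (↭-length p)) len)
            π : U ↭ T ++ R′
            π = trans q (trans (↭-reflexive (++-assoc (u ∷ pre) suf O))
              (trans (++⁺ʳ (suf ++ O) p) (↭-reflexive (++-assoc T R (suf ++ O)))))
            deg-u≡ : deg u U ≡ length T
            deg-u≡ = begin-equality
              deg u U                          ≡⟨ deg-U≡ w P ⟩
              deg u (u ∷ pre ++ suf)           ≡⟨ count-++ (adj? G) u (u ∷ pre) suf ⟩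
              deg u (u ∷ pre) + deg u suf      ≡⟨ cong₂ _+_ (≡.trans (deg-self u pre) (sym lenT))
                  (reach-++ u (u ∷ pre) suf (subst₂ _≤_ (onHead≡ reach w) (sym len) (reach≤ P))) ⟩
              length T + 0                     ≡⟨ ℕ.+-identityʳ _ ⟩
              length T                         ∎
            T>0 : 0 < length T
            T>0 = subst (0 <_) deg-u≡ (0<deg (xs⊆ (start∈ w)) (end≢start w uxs s≤))
            R>0 : 0 < length R
            R>0 = ℕ.+-cancelˡ-< (length T) 0 (length R) (begin-strict
              length T + 0          ≡⟨ ℕ.+-identityʳ _ ⟩
              length T              ≡⟨ lenT ⟩
              deg u pre             ≤⟨ length-filter (adj? G u) pre ⟩
              length pre            <⟨ ℕ.n<1+n _ ⟩
              length (u ∷ pre)      ≡⟨ ≡.trans len (sym T+R) ⟩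
              length T + length R   ∎)
            R′>0 : 0 < length R′
            R′>0 = ℕ.<-≤-trans R>0 (subst (length R ≤_) (sym (length-++ R)) (ℕ.m≤m+n _ _))
            each : ∀ {t} → t ∈ T → deg t U + deg t R′ ≤ length T + length R
            each {t} t∈ with pred t∈
            ... | as , c , bs , eq , a with rotate₂ as {r = bs ++ suf}
                    (subst Longest₂ eq′ P) (subst (λ zs → Walk u zs v) eq′ w) a
              where
              eq′ : u ∷ pre ++ suf ≡ as ++ t ∷ c ∷ bs ++ suf
              eq′ = ≡.trans (cong (_++ suf) eq) (++-assoc as (t ∷ c ∷ bs) suf)
            ... | w′ , P′ = ℕ.+-mono-≤
              (subst₂ _≤_ (onHead≡ (λ u _ → deg u U) w′) (≡.trans (onHead≡ (λ u _ → deg u U) w) deg-u≡) (deg≤ P′))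
              (begin
                deg t R′                            ≡⟨ count-++ (adj? G) t R (suf ++ O) ⟩
                deg t R + deg t (suf ++ O)          ≡⟨ cong (deg t R +_) (count-++ (adj? G) t suf O) ⟩
                deg t R + (deg t suf + deg t O)     ≡⟨ cong₂ (λ k l → deg t R + (k + l)) none-suf none-O ⟩
                deg t R + 0                         ≡⟨ ℕ.+-identityʳ _ ⟩
                deg t R                             ≤⟨ length-filter (adj? G t) R ⟩
                length R                            ∎)
              where
              pre′ = reverse (as ++ [ t ]) ++ c ∷ bs
              path = reverse (as ++ [ t ]) ++ c ∷ bs ++ suf
              path≡ : path ≡ pre′ ++ suf
              path≡ = sym (++-assoc (reverse (as ++ [ t ])) (c ∷ bs) suf)
              pre′↭ : pre′ ↭ u ∷ pre
              pre′↭ = trans (++⁺ʳ (c ∷ bs) (↭-reverse (as ++ [ t ])))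
                (↭-reflexive (≡.trans (++-assoc as [ t ] (c ∷ bs)) (sym eq)))
              -- The rotation permutes the first `j` vertices and leaves `suf` in place, so the
              -- bound on `reach` excludes neighbours in `suf`.
              none-suf : deg t suf ≡ 0
              none-suf = reach-++ t pre′ suf (subst₂ _≤_ (≡.trans (onHead≡ reach w′) (cong (reach t) path≡))
                (≡.trans (sym len) (sym (↭-length pre′↭))) (reach≤ P′))
              -- By `deg-U≡` the rotated path already contains all neighbours of `t` in `U`.
              none-O : deg t O ≡ 0
              none-O = ℕ.+-cancelˡ-≡ (deg t path) _ _ (begin-equality
                deg t path + deg t O
                  ≡⟨ cong (_+ deg t O) (count-↭ (adj? G) t (trans (↭-reflexive path≡) (++⁺ʳ suf pre′↭))) ⟩
                deg t (u ∷ pre ++ suf) + deg t O   ≡⟨ count-++ (adj? G) t (u ∷ pre ++ suf) O ⟨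
                deg t ((u ∷ pre ++ suf) ++ O)      ≡⟨ count-↭ (adj? G) t q ⟨
                deg t U                            ≡⟨ deg-U≡ w′ P′ ⟩
                deg t path                           ≡⟨ ℕ.+-identityʳ _ ⟨
                deg t path + 0                       ∎)

        -- On a longest path of largest `reach`, the last neighbour `z` of the end closes a cycle
        -- `Q` with `reach` many vertices. By `K<reach`, applied to a path whose end has largest
        -- degree, `Q` is longer than `K`. A detour through `z` exists because the path continues
        -- from `z` to `v`.
        contradictory : ∀ {xs p₀} → Longest₂ xs → p₀ ∈ ps → ⊥
        contradictory P p₀∈
          with maximal longest₂? (proj₁ ∘ proj₂ ∘ proj₁) (onHead reach) (_ , P)
             | maximal longest₂? (proj₁ ∘ proj₂ ∘ proj₁) (onHead (λ u _ → deg u U)) (_ , P)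
          where
          longest₂? : ∀ xs → Dec (Longest₂ xs)
          longest₂? xs = isPath₂? xs ×-dec s ℕ.≤? length xs
        ... | xs , P₁@(((u , w) , uxs , xs⊆ , ∉ps) , s≤) , reach≤ | ys , P₂ , deg≤
          with last-neighbour xs (subst (0 <_) (deg-U≡ w P₁) (0<deg (xs⊆ (start∈ w)) (end≢start w uxs s≤)))
        ... | front , z , back , refl , a , none with cut front w
        ... | w₁ , w₂ with detour-through w₂ (xs⊆ ∘ ∈-++⁺ʳ front) (All.++⁻ʳ front ∉ps) p₀∈
        ... | L , p , D , z∈L = no-detour-meets-cycle cyc (All.lookup ∉ps ∘ Q⊆) K<Q D z∈L (∈-insert front)
          where
          Q = front ++ [ z ]
          Q≡ : Q ++ back ≡ front ++ z ∷ back
          Q≡ = ++-assoc front [ z ] back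
          Q⊆ : Q ⊆ front ++ z ∷ back
          Q⊆ x∈ = subst (_ ∈_) Q≡ (∈-++⁺ˡ x∈)
          cyc : IsCycle U u Q
          cyc = (z , w₁ , symm G a) , Unique-++⁻ˡ Q (subst Unique (sym Q≡) uxs) , xs⊆ ∘ Q⊆
          lenQ : suc (length front) ≡ length Q
          lenQ = ↭-length (++-comm [ z ] front)
          K<Q : K < length Q
          K<Q = K<reach (subst (0 <_) lenQ z<s)
            (ℕ.≤-trans (Unique-⊆⇒length≤ (proj₁ (proj₂ cyc)) Q⊆) (maximal₂ (proj₁ P₁)))
            (λ {zs} P → subst (onHead reach zs ≤_)
              (≡.trans (onHead≡ reach w) (≡.trans (reach≡ u front z back a none) lenQ)) (reach≤ P))
            P₂ deg≤

    absurd : ⊥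
    absurd with maximal isPath₁? unique₁ length ([] , (v , [-]) , [] ∷ [] , λ { (here refl) → v∈U })
      where
      isPath₁? : ∀ ps → Dec (IsPath₁ ps)
      isPath₁? ps = Fin.any? (λ e → walk? v (v ∷ ps) e) ×-dec unique? _≟_ (v ∷ ps) ×-dec ((v ∷ ps) ⊆? U)
      unique₁ : ∀ {ps} → IsPath₁ ps → Unique ps
      unique₁ (_ , _ ∷ u , _) = u
    ... | ps , path₁ , longest with any? (λ y → adj? G v y ×-dec ¬? (y ∈? ps)) U
    ... | yes h = outer (find h)
      where
      open Longest path₁ longest
      outer : (∃ λ y → y ∈ U × Adj G v y × y ∉ ps) → ⊥
      outer (y , y∈U , a , y∉ps) = conclude (maximal isPath₂? (proj₁ ∘ proj₂) length (y ∷ [ v ] , path₂)) ps-nonempty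
        where
        y∉[v] : y ∉ [ v ]
        y∉[v] (here refl) = irrefl G refl a
        path₂ : IsPath₂ (y ∷ [ v ])
        path₂ = (y , symm G a ∷ [-]) , ∉⇒Unique-∷ y∉[v] ([] ∷ [])
          , (λ { (here refl) → y∈U ; (there (here refl)) → v∈U }) , y∉ps ∷ v∉ps ∷ []
        -- The step from `v` to `y` is itself a path, so the longest path has a vertex besides `v`.
        ps-nonempty : ∃ (_∈ ps)
        ps-nonempty = member (longest {[ y ]} ((y , a ∷ [-]) , ∉⇒Unique-∷ (λ { (here refl) → y∉[v] (here refl) }) ([] ∷ [])
          , λ { (here refl) → v∈U ; (there (here refl)) → y∈U }))
          where
          member : ∀ {qs : List V} → 0 < length qs → ∃ (_∈ qs)
          member {q ∷ _} _ = q , here refl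
        conclude : (∃ λ xs → IsPath₂ xs × (∀ {zs} → IsPath₂ zs → length zs ≤ length xs)) → ∃ (_∈ ps) → ⊥
        -- `path₂` has two vertices, which gives the bound `2 ≤ s`.
        conclude (xs , P , max₂) (_ , p₀∈) = Maximal.contradictory (max₂ path₂) max₂ (P , ℕ.≤-refl) p₀∈
    ... | no ¬h = inner (last-neighbour ps (subst (0 <_) deg-v≡ (ℕ.<-≤-trans z<s (ℕ.≤-trans 2≤K K≤deg))))
      where
      open Longest path₁ longest
      deg-v≡ : deg v U ≡ deg v ps
      deg-v≡ with complement (proj₁ (proj₂ path₁)) (proj₂ (proj₂ path₁))
      ... | O , p = begin
        deg v U                       ≡⟨ count-↭ (adj? G) v p ⟩
        deg v ((v ∷ ps) ++ O)         ≡⟨ count-++ (adj? G) v (v ∷ ps) O ⟩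
        deg v (v ∷ ps) + deg v O      ≡⟨ cong₂ _+_ (deg-self v ps) (count-none (adj? G) O outside) ⟩
        deg v ps + 0                  ≡⟨ ℕ.+-identityʳ _ ⟩
        deg v ps                      ∎
        where
        open ≡-Reasoning
        outside : ∀ {y} → y ∈ O → ¬ Adj G v y
        outside y∈ a = ¬h (lose (∈-resp-↭ (↭-sym p) (∈-++⁺ʳ (v ∷ ps) y∈))
          (a , λ y∈ps → proj₂ (proj₂ (Unique-++⁻ (v ∷ ps) (Unique-resp-↭ p uU))) (there y∈ps) y∈))
      inner : (∃₂ λ front z → ∃ λ back → ps ≡ front ++ z ∷ back × Adj G v z × deg v back ≡ 0) → ⊥
      inner (front , z , back , eq , a , none) = ℕ.<⇒≱ long (short (detour-cycle edge eq))
        where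
        open Detours U v ps
        edge : Detour [ v ] z
        edge = detour (a ∷ [-]) (subst (z ∈_) (sym eq) (∈-insert front)) ([] ∷ [])
          (λ { (here refl) → v∉ps }) (λ { (here refl) → v∈U })
        -- The path up to `z` contains all neighbours of `v`; the additional vertex is `v` itself.
        long : K < suc (length (z ∷ reverse front))
        long = s≤s (begin
          K                                          ≤⟨ K≤deg ⟩
          deg v U                                    ≡⟨ deg-v≡ ⟩
          deg v ps                                   ≡⟨ cong (deg v) (≡.trans eq (sym (++-assoc front [ z ] back))) ⟩
          deg v ((front ++ [ z ]) ++ back)           ≡⟨ count-++ (adj? G) v (front ++ [ z ]) back ⟩
          deg v (front ++ [ z ]) + deg v back        ≡⟨ cong (deg v (front ++ [ z ]) +_) none ⟩
          deg v (front ++ [ z ]) + 0                 ≡⟨ ℕ.+-identityʳ _ ⟩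
          deg v (front ++ [ z ])                     ≤⟨ length-filter (adj? G v) (front ++ [ z ]) ⟩
          length (front ++ [ z ])                    ≡⟨ ↭-length (++-comm front [ z ]) ⟩
          suc (length front)                         ≡⟨ cong suc (length-reverse front) ⟨
          length (z ∷ reverse front)                 ∎)
          where open ℕ.≤-Reasoning

  -- Minimal dense sets

  degree-sum : List V → ℕ
  degree-sum xs = pairs (adj? G) xs xs

  -- Subtracting one makes the bound additive over two sets that share a single vertex; this is what
  -- keeps a minimal dense set free of separating vertices.
  Dense : ℕ → List V → Set
  Dense K U = Unique U × K * (length U ∸ 1) < degree-sum U

  dense? : ∀ K U → Dec (Dense K U)
  dense? K U = unique? _≟_ U ×-dec K * (length U ∸ 1) ℕ.<? degree-sum U

  pairs-swap : ∀ xs ys → pairs (adj? G) xs ys ≡ pairs (adj? G) ys xs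
  pairs-swap = pairs-flip (adj? G) (adj? G) (symm G) (symm G)

  -- The first two terms count the edges meeting `S`, each twice; the last one counts those inside
  -- `R`.
  degree-sum-++ : ∀ {U} S R → U ↭ S ++ R →
                  degree-sum U ≡ (pairs (adj? G) S U + pairs (adj? G) S R) + degree-sum R
  degree-sum-++ {U} S R p = begin
    pairs A U U                                  ≡⟨ pairs-↭ A {ws = U} p refl ⟩
    pairs A (S ++ R) U                           ≡⟨ pairs-++ˡ A S R U ⟩
    pairs A S U + pairs A R U
      ≡⟨ cong (pairs A S U +_) (≡.trans (pairs-↭ A {xs = R} refl p) (pairs-++ʳ A R S R)) ⟩
    pairs A S U + (pairs A R S + pairs A R R)    ≡⟨ cong (λ k → pairs A S U + (k + pairs A R R)) (pairs-swap R S) ⟩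
    pairs A S U + (pairs A S R + pairs A R R)    ≡⟨ ℕ.+-assoc (pairs A S U) _ _ ⟨
    (pairs A S U + pairs A S R) + pairs A R R    ∎
    where
    open ≡-Reasoning
    A = adj? G

  module MinimalDense {K} (2≤K : 2 ≤ K) {U} (uU : Unique U) (dense : K * (length U ∸ 1) < degree-sum U)
    (minimal : ∀ {X} → Unique X → length X < length U → degree-sum X ≤ K * (length X ∸ 1)) where

    -- `R` is smaller than `U` and hence not dense. The difference of the two bounds is
    -- `K * length S`.
    removal : ∀ S R → U ↭ S ++ R → 0 < length S → 0 < length R →
              length S * K < sum (map (λ u → deg u U + deg u R) S)
    removal S R p S>0 R>0 = subst (length S * K <_) (sym (sum-map-+ _ _ S))
      (ℕ.+-cancelʳ-< (K * (length R ∸ 1)) _ _ (begin-strict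
        length S * K + K * (length R ∸ 1)     ≡⟨ cong (_+ K * (length R ∸ 1)) (ℕ.*-comm (length S) K) ⟩
        K * length S + K * (length R ∸ 1)     ≡⟨ ℕ.*-distribˡ-+ K (length S) _ ⟨
        -- The truncated subtraction is exact because `R` is nonempty.
        K * (length S + (length R ∸ 1))       ≡⟨ cong (K *_) (ℕ.+-∸-assoc (length S) R>0) ⟨
        K * (length S + length R ∸ 1)         ≡⟨ cong (λ k → K * (k ∸ 1)) |U| ⟨
        K * (length U ∸ 1)                    <⟨ dense ⟩
        degree-sum U                          ≡⟨ degree-sum-++ S R p ⟩
        pairs (adj? G) S U + pairs (adj? G) S R + degree-sum R
          ≤⟨ ℕ.+-monoʳ-≤ _ (minimal uR (subst (length R <_) (sym |U|) (ℕ.+-monoˡ-< (length R) S>0))) ⟩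
        pairs (adj? G) S U + pairs (adj? G) S R + K * (length R ∸ 1) ∎))
      where
      open ℕ.≤-Reasoning
      |U| : length U ≡ length S + length R
      |U| = ≡.trans (↭-length p) (length-++ S)
      uR : Unique R
      uR = proj₁ (proj₂ (Unique-++⁻ S (Unique-resp-↭ p uU)))

    -- Without such an edge, every edge in `U` lies within `z ∷ A` or within `z ∷ C`. Both are
    -- smaller than `U`, so neither is dense, and their bounds add up to the one that `U` exceeds.
    connected : ∀ z A C → U ↭ z ∷ A ++ C → ∀ {a c} → a ∈ A → c ∈ C →
                ∃₂ λ a c → a ∈ A × c ∈ C × Adj G a c
    connected z A C p a∈ c∈ with any? (λ a → any? (adj? G a) C) A
    ... | yes h with find h
    ... | a , a∈ , h′ with find h′
    ... | c , c∈ , e = a , c , a∈ , c∈ , e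
    connected z A C p a∈ c∈ | no ¬h = contradiction dense (ℕ.≤⇒≯ (begin
      degree-sum U                                        ≡⟨ degree-sum-++ (z ∷ A) C p ⟩
      pairs D (z ∷ A) U + pairs D (z ∷ A) C + degree-sum C
        ≡⟨ cong₂ (λ k l → k + l + degree-sum C)
             (≡.trans (pairs-↭ D {xs = z ∷ A} refl p) (pairs-++ʳ D (z ∷ A) (z ∷ A) C)) zC ⟩
      degree-sum (z ∷ A) + pairs D (z ∷ A) C + pairs D [ z ] C + degree-sum C
        ≡⟨ cong (λ k → degree-sum (z ∷ A) + k + pairs D [ z ] C + degree-sum C) zC ⟩
      degree-sum (z ∷ A) + pairs D [ z ] C + pairs D [ z ] C + degree-sum C
        ≡⟨ regroup (degree-sum (z ∷ A)) _ _ _ ⟩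
      degree-sum (z ∷ A) + (pairs D [ z ] C + pairs D [ z ] C + degree-sum C)
        ≤⟨ ℕ.+-monoʳ-≤ (degree-sum (z ∷ A)) (ℕ.+-monoˡ-≤ (degree-sum C) (ℕ.+-monoˡ-≤ (pairs D [ z ] C) z-zC)) ⟩
      degree-sum (z ∷ A) + (pairs D [ z ] (z ∷ C) + pairs D [ z ] C + degree-sum C)
        ≡⟨ cong (degree-sum (z ∷ A) +_) (degree-sum-++ [ z ] C refl) ⟨
      degree-sum (z ∷ A) + degree-sum (z ∷ C)
        ≤⟨ ℕ.+-mono-≤ (minimal uzA (small (∈-length c∈) |U|)) (minimal uzC (small (∈-length a∈) |U|′)) ⟩
      K * length A + K * length C                         ≡⟨ ℕ.*-distribˡ-+ K (length A) (length C) ⟨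
      K * (length A + length C)                           ≡⟨ cong (λ k → K * (k ∸ 1)) |U| ⟨
      K * (length U ∸ 1)                                  ∎))
      where
      open ℕ.≤-Reasoning
      D = adj? G
      regroup : ∀ a b c d → a + b + c + d ≡ a + (b + c + d)
      regroup = solve-∀
      |U| : length U ≡ suc (length A + length C)
      |U| = ≡.trans (↭-length p) (cong suc (length-++ A))
      |U|′ : length U ≡ suc (length C + length A)
      |U|′ = ≡.trans |U| (cong suc (ℕ.+-comm (length A) _))
      small : ∀ {a c} → 0 < c → length U ≡ suc (a + c) → suc a < length U
      small {a} {c} c>0 eq = subst (suc a <_) (sym eq) (s≤s (subst (_< a + c) (ℕ.+-identityʳ a) (ℕ.+-monoʳ-< a c>0)))
      uzA : Unique (z ∷ A)
      uzA = Unique-++⁻ˡ (z ∷ A) (Unique-resp-↭ p uU)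
      uzC : Unique (z ∷ C)
      uzC = Unique-++⁻ˡ (z ∷ C) (Unique-resp-↭ (trans p (prep z (++-comm A C))) uU)
      zC : pairs D (z ∷ A) C ≡ pairs D [ z ] C
      zC = ≡.trans (pairs-++ˡ D [ z ] A C) (≡.trans (cong (pairs D [ z ] C +_)
        (pairs-none D A C λ a∈ c∈ e → ¬h (lose a∈ (lose c∈ e)))) (ℕ.+-identityʳ _))
      z-zC : pairs D [ z ] C ≤ pairs D [ z ] (z ∷ C)
      z-zC = subst (pairs D [ z ] C ≤_) (sym (pairs-++ʳ D [ z ] [ z ] C)) (ℕ.m≤n+m _ (pairs D [ z ] [ z ]))

    -- If all degrees were below `K`, comparing the degree sum with density would force
    -- `length U < K`. All degrees are below `length U` as well, and the same comparison then forces
    -- `K < length U`.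
    high-degree : ∃ λ v → v ∈ U × K ≤ deg v U
    high-degree with any? (λ v → K ℕ.≤? deg v U) U
    ... | yes h = find h
    ... | no ¬h = contradiction U<K (ℕ.<⇒≯ K<U)
      where
      bound : ∀ m → (∀ {u} → u ∈ U → deg u U < m) → K * (length U ∸ 1) < length U * (m ∸ 1)
      bound m lt = ℕ.<-≤-trans dense (ℕ.≤-trans (sum-map-≤ U (ℕ.∸-monoˡ-≤ 1 ∘ lt)) (ℕ.≤-reflexive (sum-map-const (m ∸ 1) U)))
      cross : ∀ a b → a * (b ∸ 1) < b * (a ∸ 1) → b < a
      cross zero (suc b) lt = contradiction (subst (0 <_) (ℕ.*-zeroʳ (suc b)) lt) λ ()
      cross (suc a) (suc b) lt = s≤s (ℕ.+-cancelʳ-< (a * b) b a (subst (λ k → b + a * b < a + k) (ℕ.*-comm b a) lt))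
      cross (suc a) zero ()
      U<K : length U < K
      U<K = cross K (length U) (bound K λ u∈ → ℕ.≰⇒> λ K≤ → ¬h (lose u∈ K≤))
      K<U : K < length U
      K<U = ℕ.*-cancelʳ-< (length U ∸ 1) K (length U)
        (bound (length U) λ u∈ → filter-notAll (adj? G _) U (lose u∈ (irrefl G refl)))

    long-cycle : ∃₂ λ v xs → IsCycle U v xs × K < length xs × K ≤ deg v U
    long-cycle with high-degree
    ... | v , v∈ , K≤ with anyList? (λ xs → isCycle? U v xs ×-dec K ℕ.<? length xs) (proj₁ ∘ proj₂ ∘ proj₁)
    ... | yes (xs , cyc , long) = v , xs , cyc , long , K≤
    ... | no ¬h = ⊥-elim (LongCycle.absurd uU K 2≤K v∈ removal connected K≤ λ cyc → ℕ.≮⇒≥ λ long → ¬h (_ , cyc , long))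

  -- Maximising `n ∸ length U` selects a smallest dense set. The search can start from the set of
  -- all vertices, which is dense by the bound on `size G`.
  dense⇒long-cycle : ∀ {K} → 2 ≤ K → K * n < 2 * size G →
    ∃ λ U → Unique U × ∃₂ λ v xs → IsCycle U v xs × K < length xs × K ≤ deg v U
  dense⇒long-cycle {K} 2≤K large with maximal (dense? K) proj₁ (λ U → n ∸ length U) (allFin n , Unique.allFin⁺ n , init)
    where
    init : K * (length (allFin n) ∸ 1) < degree-sum (allFin n)
    init = begin-strict
      K * (length (allFin n) ∸ 1)   ≡⟨ cong (λ k → K * (k ∸ 1)) (length-tabulate {n = n} (λ i → i)) ⟩
      K * (n ∸ 1)                   ≤⟨ ℕ.*-monoʳ-≤ K (ℕ.m∸n≤m n 1) ⟩
      K * n                         <⟨ large ⟩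
      2 * size G                    ≡⟨ size-handshake G ⟩
      degree-sum (allFin n)         ∎
      where open ℕ.≤-Reasoning
  ... | U , (uU , dense) , least = U , uU , MinimalDense.long-cycle 2≤K uU dense λ {X} uX smaller →
    ℕ.≮⇒≥ λ denseX → ℕ.<⇒≱ (ℕ.∸-monoʳ-< smaller (Unique⇒length≤ uU)) (least (uX , denseX))

  -- Keyrings from long cycles

  lookup-step : ∀ {a xs b} → Walk a xs b → ∀ i j → toℕ j ≡ suc (toℕ i) → Adj G (lookup xs i) (lookup xs j)
  lookup-step [-] zero zero ()
  lookup-step (e ∷ [-]) zero (suc zero) _ = e
  lookup-step (e ∷ (_ ∷ _)) zero (suc zero) _ = e
  lookup-step (_ ∷ w) (suc i) (suc j) eq = lookup-step w i j (ℕ.suc-injective eq)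

  lookup-last : ∀ {a xs b} → Walk a xs b → ∀ i → suc (toℕ i) ≡ length xs → lookup xs i ≡ b
  lookup-last [-] zero _ = refl
  lookup-last (_ ∷ [-]) zero ()
  lookup-last (_ ∷ (_ ∷ _)) zero ()
  lookup-last (_ ∷ w) (suc i) eq = lookup-last w i (ℕ.suc-injective eq)

  keyring-embedding : ∀ {v x y zs e} ls → Walk v (v ∷ x ∷ y ∷ zs) e → Adj G e v →
    Unique (ls ++ v ∷ x ∷ y ∷ zs) → All (Adj G v) ls → G Contains keyring (length zs) zero (length ls)
  keyring-embedding {v} {x} {y} {zs} {e} ls w cl u adjacent = g ∘ splitAt r
    , (λ {i} {j} eq → ≡.trans (sym (Fin.join-splitAt r N i))
        (≡.trans (cong (Fin.join r N) (g-inj (splitAt r i) (splitAt r j) eq)) (Fin.join-splitAt r N j)))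
    , λ i j → g-adj (splitAt r i) (splitAt r j)
    where
    rim = v ∷ x ∷ y ∷ zs
    N = length rim
    r = length ls
    g : Fin r ⊎ Fin N → Fin n
    g = [ lookup ls , lookup rim ]′
    ls∩rim : ∀ {y} → y ∈ ls → y ∉ rim
    ls∩rim = proj₂ (proj₂ (Unique-++⁻ ls u))
    g-inj : ∀ s t → g s ≡ g t → s ≡ t
    g-inj (inj₁ i) (inj₁ j) eq = cong inj₁ (lookup-injective (Unique-++⁻ˡ ls u) eq)
    g-inj (inj₂ i) (inj₂ j) eq = cong inj₂ (lookup-injective (proj₁ (proj₂ (Unique-++⁻ ls u))) eq)
    g-inj (inj₁ i) (inj₂ j) eq = contradiction (subst (_∈ rim) (sym eq) (∈-lookup j)) (ls∩rim (∈-lookup i))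
    g-inj (inj₂ i) (inj₁ j) eq = contradiction (subst (_∈ rim) eq (∈-lookup i)) (ls∩rim (∈-lookup j))
    next-adj : ∀ i j → Next i j → Adj G (lookup rim i) (lookup rim j)
    next-adj i j (inj₁ eq) = lookup-step w i j eq
    -- The closing edge: the last rim vertex is followed by `v`, at position `zero`.
    next-adj i zero (inj₂ (eq , refl)) = subst (λ z → Adj G z v) (sym (lookup-last w i eq)) cl
    g-adj : ∀ s t → LeafAdj (cycle (length zs)) zero r s t → Adj G (g s) (g t)
    g-adj (inj₁ i) (inj₂ _) refl = symm G (All.lookup adjacent (∈-lookup i))
    g-adj (inj₂ _) (inj₁ j) refl = All.lookup adjacent (∈-lookup j)
    g-adj (inj₂ i) (inj₂ j) (inj₁ nx) = next-adj i j nx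
    g-adj (inj₂ i) (inj₂ j) (inj₂ nx) = symm G (next-adj j i nx)

  ContainsKeyring : ℕ → ℕ → Set
  ContainsKeyring k r = Σ ℕ λ m → Σ (Fin (3 + m)) λ v → (k ≤ size (keyring m v r)) × (G Contains keyring m v r)

  cycle+leaves⇒keyring : ∀ {v e K} xs ls → Walk v (v ∷ xs) e → Adj G e v → 2 ≤ length xs →
    Unique (ls ++ v ∷ xs) → All (Adj G v) ls → K ≤ length ls + length xs → ContainsKeyring (suc K) (length ls)
  cycle+leaves⇒keyring (x ∷ []) _ _ _ (s≤s ()) _ _ _
  cycle+leaves⇒keyring {K = K} (x ∷ y ∷ zs) ls w cl _ u adjacent le = length zs , zero
    , ℕ.≤-trans (subst (suc K ≤_) (sym (ℕ.+-suc (length ls) (2 + length zs))) (s≤s le))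
        (size-keyring (length zs) zero (length ls))
    , keyring-embedding ls w cl u adjacent

  -- Write `K` for `r + (2 + o)`. After `1 + o` vertices of the cycle beyond `v`, the next neighbour
  -- `c` of `v` closes a cycle by a chord or by the last edge. It has at least `2 + o` vertices
  -- besides `v` and contains at most `2 + o` neighbours of `v`, so `r` others remain as leaves.
  long-cycle⇒keyring : ∀ {U v xs} r o → Unique U → IsCycle U v xs → r + (2 + o) < length xs →
                       r + (2 + o) ≤ deg v U → ContainsKeyring (suc (r + (2 + o))) r
  long-cycle⇒keyring {xs = []} r o _ _ () _
  long-cycle⇒keyring {U} {v} {x ∷ xs} r o uU ((e , w , cl) , u , xs⊆) long K≤ with start≡ w
  ... | refl = cut-at (splitAt-length (suc o) xs (ℕ.≤-trans (ℕ.n≤1+n _) (ℕ.≤-trans (ℕ.m≤n+m _ r) (s≤s⁻¹ long))))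
    where
    cut-at : (∃₂ λ as bs → xs ≡ as ++ bs × length as ≡ suc o) → ContainsKeyring (suc (r + (2 + o))) r
    cut-at (as , [] , refl , len) = contradiction (s≤s⁻¹ long) (ℕ.<⇒≱ (subst (_< r + (2 + o))
      (sym (≡.trans (cong length (++-identityʳ as)) len)) (ℕ.m≤n+m _ r)))
    cut-at (as , b ∷ bs , refl , len) with cut (v ∷ as) w
    -- The last vertex `e` of the cycle is a neighbour of `v`, so the search succeeds.
    ... | _ , w₂ with firstHit (adj? G v) (lose (end∈ w₂) (symm G cl))
    ... | cs , c , ds , eq , a , none = subst (ContainsKeyring _) |ls|
          (cycle+leaves⇒keyring short ls walk′ (symm G a) (subst (2 ≤_) (sym |short|) (s≤s (s≤s z≤n)))
            unique′ (All.tabulate λ x∈ → proj₂ (∈-filter⁻ (adj? G v) {xs = O} (ls⊆ x∈)))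
            (subst₂ (λ k l → r + (2 + o) ≤ k + l) (sym |ls|) (sym |short|) (ℕ.+-monoʳ-≤ r (s≤s (s≤s (ℕ.m≤m+n o _))))))
      where
      short = as ++ cs ++ [ c ]
      |short| : length short ≡ 2 + (o + length cs)
      |short| = ≡.trans (length-++ as) (≡.trans (cong₂ _+_ len (↭-length (++-comm cs [ c ]))) (cong suc (ℕ.+-suc o _)))
      eq′ : v ∷ as ++ b ∷ bs ≡ (v ∷ short) ++ ds
      eq′ = cong (v ∷_) (≡.trans (cong (as ++_) (≡.trans eq (sym (++-assoc cs [ c ] ds))))
        (sym (++-assoc as (cs ++ [ c ]) ds)))
      walk′ : Walk v (v ∷ short) c
      walk′ = subst (λ zs → Walk v (v ∷ zs) c) (++-assoc as cs [ c ])
        (proj₁ (cut (v ∷ as ++ cs) (subst (λ zs → Walk v (v ∷ zs) e)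
          (≡.trans (cong (as ++_) eq) (sym (++-assoc as cs (c ∷ ds)))) w)))
      short⊆U : v ∷ short ⊆ U
      short⊆U {y} y∈ = xs⊆ (subst (y ∈_) (sym eq′) (∈-++⁺ˡ y∈))
      u-short : Unique (v ∷ short)
      u-short = Unique-++⁻ˡ (v ∷ short) (subst Unique eq′ u)
      O = proj₁ (complement u-short short⊆U)
      p = proj₂ (complement u-short short⊆U)
      ls = take r (filter (adj? G v) O)
      ls⊆ : ls ⊆ filter (adj? G v) O
      ls⊆ {y} y∈ = subst (y ∈_) (take++drop≡id r (filter (adj? G v) O)) (∈-++⁺ˡ y∈)
      unique′ : Unique (ls ++ v ∷ short)
      unique′ = Unique.++⁺ (Unique.take⁺ r (Unique.filter⁺ (adj? G v) (proj₁ (proj₂ split)))) u-short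
        λ (x∈ls , x∈) → proj₂ (proj₂ split) x∈ (proj₁ (∈-filter⁻ (adj? G v) {xs = O} (ls⊆ x∈ls)))
        where
        split = Unique-++⁻ (v ∷ short) (Unique-resp-↭ p uU)
      -- By the choice of `c` no vertex of `cs` is a neighbour, so only `as` and `c` count.
      deg-short : deg v short ≤ 2 + o
      deg-short = begin
        deg v short
          ≡⟨ ≡.trans (count-++ (adj? G) v as _) (cong (deg v as +_) (count-++ (adj? G) v cs [ c ])) ⟩
        deg v as + (deg v cs + deg v [ c ])
          ≡⟨ cong (λ k → deg v as + (k + deg v [ c ])) (count-none (adj? G) cs none) ⟩
        deg v as + deg v [ c ]                     ≤⟨ ℕ.+-mono-≤ (length-filter (adj? G v) as) (length-filter (adj? G v) [ c ]) ⟩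
        length as + 1                              ≡⟨ ≡.trans (cong (_+ 1) len) (ℕ.+-comm (suc o) 1) ⟩
        2 + o                                      ∎
        where open ℕ.≤-Reasoning
      |ls| : length ls ≡ r
      |ls| = ≡.trans (length-take r _) (ℕ.m≤n⇒m⊓n≡m (ℕ.+-cancelʳ-≤ (2 + o) r _ (begin
        r + (2 + o)                    ≤⟨ K≤ ⟩
        deg v U                        ≡⟨ count-↭ (adj? G) v p ⟩
        deg v ((v ∷ short) ++ O)       ≡⟨ count-++ (adj? G) v (v ∷ short) O ⟩
        deg v (v ∷ short) + deg v O    ≡⟨ cong (_+ deg v O) (deg-self v short) ⟩
        deg v short + deg v O          ≤⟨ ℕ.+-monoˡ-≤ (deg v O) deg-short ⟩
        2 + o + deg v O                ≡⟨ ℕ.+-comm (2 + o) _ ⟩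
        deg v O + (2 + o)              ∎)))
        where open ℕ.≤-Reasoning

  dense⇒keyring : ∀ r o → (r + (2 + o)) * n < 2 * size G → ContainsKeyring (suc (r + (2 + o))) r
  dense⇒keyring r o large =
    let U , uU , v , xs , cyc , long , K≤ = dense⇒long-cycle (ℕ.≤-trans (s≤s (s≤s z≤n)) (ℕ.m≤n+m (2 + o) r)) large
    in long-cycle⇒keyring r o uU cyc long K≤

theorem4 : (k r : ℕ) → r + 3 ≤ k →
    (n : ℕ) (G : Graph n) → (k ∸ 1) * n < 2 * size G →
    Σ ℕ λ m → Σ (Fin (3 + m)) λ v →
    (k ≤ size (keyring m v r)) × (G Contains keyring m v r)
theorem4 k r r+3≤k n G =
  -- The slack `o` turns `k ∸ 1` into `r + (2 + o)`, which is at least 2.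
  let o , r+3+o≡k = ℕ.m≤n⇒∃[o]m+o≡n r+3≤k
      k≡ = ≡.trans (sym (≡.trans (ℕ.+-assoc r 3 o) (ℕ.+-suc r (2 + o)))) r+3+o≡k
  in subst (λ k → (k ∸ 1) * n < 2 * size G → ContainsKeyring G k r) k≡ (dense⇒keyring G r o)
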